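{- Let $\Delta\ge 6$ and let $n=k\Delta+1+j$, where $k\geq\Delta-1$ and $1\leq j\leq\Delta-1$ are integers. Then the family $\mathcal{T}'_{n,\Delta}$ is not empty and all trees in $\mathcal{T}'_{n,\Delta}$ have the same value of $\sigma$-irregularity.
   Context: For a graph $G$, $\sigma(G)=\sum_{uv\in E(G)}(d(u)-d(v))^2$, where $d(u)$ is the degree of $u$. For a tree $T$, $n_i$ is the number of vertices of degree $i$, and $m_{ij}=m_{ji}$ is the number of edges whose end-vertices have degrees $i$ and $j$. An internal leaf of a tree is a vertex of degree at least $2$ having precisely one neighbor of degree greater than $1$. The family $\mathcal{T}'_{n,\Delta}$ consists of all trees $T$ on $n$ vertices with maximum degree $\Delta$ such that: (1) all internal leaves of $T$ have degree $\Delta$; (2) $m_{22}\le 2$ and $m_{\Delta\Delta}=0$; (3) $\sum_{i=3}^{\Delta-1}n_i\le 1$; (4) $m_{22}=0$ if and only if $\sum_{i=3}^{\Delta-1}n_i=n_a=1$ for some $a\in\{3,\ldots,\Delta-1\}$; (5) if $m_{22}=0$, then $m_{a2}=a$, where $a$ is the degree from (4). -}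

module Defs where

open import Data.Nat using (ℕ; _+_; _∸_; _≤_; _<_; _≟_; _<?_)
open import Data.Integer as ℤ using (ℤ; +_; 0ℤ)
open import Data.Fin as Fin using (Fin)
import Data.Fin.Properties as Fin
open import Data.List using (List; _∷_; _∷ʳ_; length; filter; map; foldr; sum; applyUpTo; allFin; cartesianProduct)
open import Data.List.Relation.Unary.Linked using (Linked)
open import Data.List.Relation.Unary.Unique.Propositional using (Unique)
open import Data.Product using (_×_; _,_; ∃-syntax)
open import Function.Bundles using (_⇔_)
open import Level using (0ℓ)
open import Relation.Binary using (Rel; Decidable; Symmetric; Irreflexive)
open import Relation.Binary.Construct.Closure.ReflexiveTransitive using (Star)
open import Relation.Binary.PropositionalEquality using (_≡_)
open import Relation.Nullary using (¬_)
open import Relation.Nullary.Decidable using (_×-dec_; _⊎-dec_)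

record SimpleGraph (n : ℕ) : Set₁ where
  field
    Adj    : Rel (Fin n) 0ℓ
    adj?   : Decidable Adj
    symm   : Symmetric Adj
    irrefl : Irreflexive _≡_ Adj

module _ {n : ℕ} (G : SimpleGraph n) where
  open SimpleGraph G

  -- The cycle u, v₁, …, vₘ, u with m ≥ 2 and u, v₁, …, vₘ distinct.
  record IsCycle (u : Fin n) (vs : List (Fin n)) : Set where
    field
      long     : 2 ≤ length vs
      distinct : Unique (u ∷ vs)
      closed   : Linked Adj (u ∷ (vs ∷ʳ u))

  record IsTree : Set where
    field
      nonempty  : 0 < n
      connected : ∀ u v → Star Adj u v
      acyclic   : ∀ u vs → ¬ IsCycle u vs

  degree : Fin n → ℕ
  degree v = length (filter (adj? v) (allFin n))

  -- Each edge is listed once, with its smaller endpoint first.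
  edges : List (Fin n × Fin n)
  edges = filter (λ (u , v) → (u Fin.<? v) ×-dec adj? u v)
                 (cartesianProduct (allFin n) (allFin n))

  σ : ℤ
  σ = foldr ℤ._+_ 0ℤ (map (λ (u , v) → (+ degree u ℤ.- + degree v) ℤ.^ 2) edges)

  -- nᵢ
  #deg : ℕ → ℕ
  #deg i = length (filter (λ v → degree v ≟ i) (allFin n))

  -- mᵢⱼ
  #edge : ℕ → ℕ → ℕ
  #edge i j = length (filter
    (λ (u , v) → ((degree u ≟ i) ×-dec (degree v ≟ j))
           ⊎-dec ((degree u ≟ j) ×-dec (degree v ≟ i)))
    edges)

  -- n₃ + ⋯ + n_{Δ-1}
  Σ#deg : ℕ → ℕ
  Σ#deg Δ = sum (applyUpTo (λ i → #deg (3 + i)) (Δ ∸ 3))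

  IsMaxDegree : ℕ → Set
  IsMaxDegree Δ = (∀ v → degree v ≤ Δ) × (∃[ v ] degree v ≡ Δ)

  IsInternalLeaf : Fin n → Set
  IsInternalLeaf v =
    2 ≤ degree v ×
    length (filter (λ w → adj? v w ×-dec (1 <? degree w)) (allFin n)) ≡ 1

  -- a ∈ {3, …, Δ-1} and n₃ + ⋯ + n_{Δ-1} = nₐ = 1
  IsExceptionalDegree : ℕ → ℕ → Set
  IsExceptionalDegree Δ a = 3 ≤ a × a ≤ Δ ∸ 1 × Σ#deg Δ ≡ #deg a × #deg a ≡ 1

-- Membership in 𝒯′_{n,Δ}, for trees with vertex set Fin n.
record 𝒯′ (n Δ : ℕ) (T : SimpleGraph n) : Set where
  field
    isTree    : IsTree T
    maxDegree : IsMaxDegree T Δ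
    cond₁     : ∀ v → IsInternalLeaf T v → degree T v ≡ Δ
    cond₂     : #edge T 2 2 ≤ 2 × #edge T Δ Δ ≡ 0
    cond₃     : Σ#deg T Δ ≤ 1
    cond₄     : #edge T 2 2 ≡ 0 ⇔ (∃[ a ] IsExceptionalDegree T Δ a)
    cond₅     : #edge T 2 2 ≡ 0 → ∀ a → IsExceptionalDegree T Δ a → #edge T a 2 ≡ a

module Submission where

-- In a member of 𝒯′ every edge joins a leaf to a vertex of degree Δ or has an end of degree 2.  On such edges
-- (d u - d w)² = h (d u) + h (d w) for a suitable potential h, so σ is the sum of d v · h (d v) over the vertices
-- and depends only on the degrees.  Counting the edges by their ends of degree ≥ 3 gives
-- Δ n_Δ + r = n - 1 = k Δ + j, where r is m₂₂ if there is no vertex of degree 3, …, Δ - 1 and the degree of that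
-- vertex otherwise; as r < Δ, this forces n_Δ = k and r = j, and hence all the degrees.
-- For existence, start from the star K_{1,j} (from K₂ if j = 1) and k times turn a leaf into a vertex of degree 2
-- by giving it a child of degree Δ that carries Δ - 1 new leaves, treating the leaves of the initial star first.
-- Each step adds Δ vertices, and the same count of edges then yields m₂₂.

open import Data.Bool using (if_then_else_)
open import Data.Empty using (⊥; ⊥-elim)
open import Data.Fin as Fin using (Fin; zero; suc)
import Data.Fin.Properties as Fin
open import Data.Integer as ℤ using (ℤ; 0ℤ)
import Data.Integer.Properties as ℤ
open import Data.Integer.Tactic.RingSolver using () renaming (solve-∀ to solveℤ-∀)
open import Data.List using (List; []; _∷_; _++_; _∷ʳ_; length; filter; map; foldr; applyUpTo; allFin; cartesianProduct)
open import Data.List.Membership.Propositional using (_∈_; _∉_)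
open import Data.List.Membership.Propositional.Properties using (∈-allFin; ∈-filter⁻)
open import Data.List.Membership.Propositional.Properties.WithK using (unique∧set⇒bag)
open import Data.List.Properties using (map-∘; map-++; map-tabulate; length-map; length-tabulate)
open import Data.List.Relation.Binary.BagAndSetEquality using (∼bag⇒↭)
open import Data.List.Relation.Binary.Permutation.Propositional using (_↭_; ↭-sym)
import Data.List.Relation.Binary.Permutation.Propositional.Properties as ↭
open import Data.List.Relation.Unary.All as All using (All; []; _∷_)
open import Data.List.Relation.Unary.All.Properties using (All¬⇒¬Any; ¬Any⇒All¬)
open import Data.List.Relation.Unary.AllPairs using ([]; _∷_)
open import Data.List.Relation.Unary.Any using (here; there)
open import Data.List.Relation.Unary.Linked using (Linked; [-]; _∷_)
import Data.List.Relation.Unary.Linked.Properties as Linked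
open import Data.List.Relation.Unary.Unique.Propositional using (Unique)
import Data.List.Relation.Unary.Unique.Propositional.Properties as Unique
open import Data.Nat
open import Data.Nat.DivMod using (_%_; [m+kn]%n≡m%n; m<n⇒m%n≡m)
open import Data.Nat.ListAction using (sum)
open import Data.Nat.ListAction.Properties using (sum-++; sum-↭)
open import Data.Nat.Properties
open import Data.Nat.Tactic.RingSolver using (solve-∀)
open import Data.Product using (_×_; _,_; proj₁; proj₂; ∃; ∃-syntax; uncurry)
open import Data.Sum using (_⊎_; inj₁; inj₂; swap) renaming ([_,_]′ to [_,_])
open import Function using (_∘_; id)
open import Function.Bundles using (mk⇔; Equivalence)
open import Relation.Binary using (tri<; tri≈; tri>)
open import Relation.Binary.Construct.Closure.ReflexiveTransitive as Star using (Star; ε; _◅_; _◅◅_)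
open import Relation.Binary.PropositionalEquality hiding ([_])
open import Relation.Nullary using (¬_; Dec; yes; no; does; contradiction)
open import Relation.Nullary.Decidable using (_×-dec_; _⊎-dec_; ¬?; decidable-stable)
open import Relation.Unary using (Decidable)
open import Defs

-- On an edge with an end of degree 2 the squared difference is (d - 2)², where d is the degree of
-- the other end, so (x - 2)² already serves as a potential there. The remaining edges join a leaf
-- to a vertex of degree Δ and contribute (Δ - 1)². Every leaf lies on such an edge, so its
-- potential is free to absorb the excess (Δ - 1)² - (Δ - 2)². What is then left open is the number
-- of leaves, which in a tree is 2 + ∑ (d ∸ 2), again a function of the larger degrees. The
-- conditions of the family share the work of forcing the edge shape: (1) keeps leaves away from
-- vertices of degree at most 2, (2) separates the vertices of degree Δ, and (3) to (5) leave at
-- most one vertex of intermediate degree and surround it by vertices of degree 2. The bound k ≥ Δ -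
-- 1 enters through existence: all leaves of the initial star have to be expanded, which takes j ≤ Δ
-- - 1 steps, or two steps for K₂.

private variable
  A B P Q : Set
  m n : ℕ

-- Sums over lists

-- Iverson bracket. It reads only `does`, so it computes on numerals, and `⟦ suc u Fin.≟ suc v ⟧`
-- reduces to `⟦ u Fin.≟ v ⟧`.
⟦_⟧ : Dec P → ℕ
⟦ d ⟧ = if does d then 1 else 0

⟦⟧-yes : (d : Dec P) → P → ⟦ d ⟧ ≡ 1
⟦⟧-yes (yes _) _ = refl
⟦⟧-yes (no ¬p) p = contradiction p ¬p

⟦⟧-no : (d : Dec P) → ¬ P → ⟦ d ⟧ ≡ 0
⟦⟧-no (yes p) ¬p = contradiction p ¬p
⟦⟧-no (no _)  _  = refl

⟦⟧≤1 : (d : Dec P) → ⟦ d ⟧ ≤ 1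
⟦⟧≤1 (yes _) = ≤-refl
⟦⟧≤1 (no _)  = z≤n

⟦⟧≡1⇒ : (d : Dec P) → ⟦ d ⟧ ≡ 1 → P
⟦⟧≡1⇒ (yes p) _ = p

⟦⟧-mono : (d : Dec P) (e : Dec Q) → (P → Q) → ⟦ d ⟧ ≤ ⟦ e ⟧
⟦⟧-mono (yes p) e f = ≤-reflexive (sym (⟦⟧-yes e (f p)))
⟦⟧-mono (no _)  e f = z≤n

⟦⟧-cong : (d : Dec P) (e : Dec Q) → (P → Q) → (Q → P) → ⟦ d ⟧ ≡ ⟦ e ⟧
⟦⟧-cong d e f g = ≤-antisym (⟦⟧-mono d e f) (⟦⟧-mono e d g)

⟦⟧-× : (d : Dec P) (e : Dec Q) → ⟦ d ×-dec e ⟧ ≡ ⟦ d ⟧ * ⟦ e ⟧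
⟦⟧-× (yes _) e = sym (*-identityˡ ⟦ e ⟧)
⟦⟧-× (no _)  e = refl

⟦⟧*-cong : (d : Dec P) {x y : ℕ} → (P → x ≡ y) → ⟦ d ⟧ * x ≡ ⟦ d ⟧ * y
⟦⟧*-cong (yes p) e = cong (1 *_) (e p)
⟦⟧*-cong (no _)  e = refl

∑ : List A → (A → ℕ) → ℕ
∑ xs f = sum (map f xs)

infixr 6.5 ∑
syntax ∑ xs (λ x → e) = ∑[ x ∈ xs ] e

∑-cong-∈ : ∀ (xs : List A) {f g : A → ℕ} → (∀ {x} → x ∈ xs → f x ≡ g x) → ∑ xs f ≡ ∑ xs g
∑-cong-∈ []       e = refl
∑-cong-∈ (x ∷ xs) e = cong₂ _+_ (e (here refl)) (∑-cong-∈ xs (e ∘ there))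

∑-cong : ∀ (xs : List A) {f g : A → ℕ} → (∀ x → f x ≡ g x) → ∑ xs f ≡ ∑ xs g
∑-cong xs e = ∑-cong-∈ xs (λ {x} _ → e x)

∑-mono : ∀ (xs : List A) {f g : A → ℕ} → (∀ x → f x ≤ g x) → ∑ xs f ≤ ∑ xs g
∑-mono []       e = z≤n
∑-mono (x ∷ xs) e = +-mono-≤ (e x) (∑-mono xs e)

∑-+ : ∀ (xs : List A) (f g : A → ℕ) → ∑[ x ∈ xs ] (f x + g x) ≡ ∑ xs f + ∑ xs g
∑-+ []       f g = refl
∑-+ (x ∷ xs) f g = trans (cong (f x + g x +_) (∑-+ xs f g)) (interchange (f x) (g x) (∑ xs f) (∑ xs g))
  where
  interchange : ∀ a b c d → (a + b) + (c + d) ≡ (a + c) + (b + d)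
  interchange = solve-∀

∑-*ˡ : ∀ (xs : List A) c (f : A → ℕ) → ∑[ x ∈ xs ] (c * f x) ≡ c * ∑ xs f
∑-*ˡ []       c f = sym (*-zeroʳ c)
∑-*ˡ (x ∷ xs) c f = trans (cong (c * f x +_) (∑-*ˡ xs c f)) (sym (*-distribˡ-+ c (f x) (∑ xs f)))

∑-*ʳ : ∀ (xs : List A) c (f : A → ℕ) → ∑[ x ∈ xs ] (f x * c) ≡ ∑ xs f * c
∑-*ʳ xs c f = trans (∑-cong xs (λ x → *-comm (f x) c)) (trans (∑-*ˡ xs c f) (*-comm c (∑ xs f)))

∑-const : ∀ (xs : List A) c → ∑[ _ ∈ xs ] c ≡ length xs * c
∑-const []       c = refl
∑-const (x ∷ xs) c = cong (c +_) (∑-const xs c)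

∑-swap : ∀ (xs : List A) (ys : List B) (f : A → B → ℕ) →
         ∑[ x ∈ xs ] ∑[ y ∈ ys ] f x y ≡ ∑[ y ∈ ys ] ∑[ x ∈ xs ] f x y
∑-swap []       ys f = sym (trans (∑-const ys 0) (*-zeroʳ (length ys)))
∑-swap (x ∷ xs) ys f = trans (cong (∑ ys (f x) +_) (∑-swap xs ys f)) (sym (∑-+ ys (f x) _))

∑-++ : ∀ (xs ys : List A) (f : A → ℕ) → ∑ (xs ++ ys) f ≡ ∑ xs f + ∑ ys f
∑-++ xs ys f = trans (cong sum (map-++ f xs ys)) (sum-++ (map f xs) (map f ys))

∑-map : ∀ (xs : List A) (g : A → B) (f : B → ℕ) → ∑ (map g xs) f ≡ ∑ xs (f ∘ g)
∑-map xs g f = cong sum (sym (map-∘ xs))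

∑-cartesianProduct : ∀ (xs : List A) (ys : List B) (f : A × B → ℕ) →
                     ∑ (cartesianProduct xs ys) f ≡ ∑[ x ∈ xs ] ∑[ y ∈ ys ] f (x , y)
∑-cartesianProduct []       ys f = refl
∑-cartesianProduct (x ∷ xs) ys f =
  trans (∑-++ (map (x ,_) ys) (cartesianProduct xs ys) f)
        (cong₂ _+_ (∑-map ys (x ,_) f) (∑-cartesianProduct xs ys f))

module _ {A : Set} {P : A → Set} (P? : Decidable P) where

  ∑-filter : ∀ xs (f : A → ℕ) → ∑ (filter P? xs) f ≡ ∑[ x ∈ xs ] ⟦ P? x ⟧ * f x
  ∑-filter []       f = refl
  ∑-filter (x ∷ xs) f with P? x
  ... | yes _ = cong₂ _+_ (sym (+-identityʳ (f x))) (∑-filter xs f)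
  ... | no  _ = ∑-filter xs f

  length-filter≡∑ : ∀ xs → length (filter P? xs) ≡ ∑[ x ∈ xs ] ⟦ P? x ⟧
  length-filter≡∑ []       = refl
  length-filter≡∑ (x ∷ xs) with P? x
  ... | yes _ = cong suc (length-filter≡∑ xs)
  ... | no  _ = length-filter≡∑ xs

∑-↭ : ∀ {xs ys : List A} (f : A → ℕ) → xs ↭ ys → ∑ xs f ≡ ∑ ys f
∑-↭ f p = sum-↭ (↭.map⁺ f p)

-- Equal totals leave no slack in any term. This turns the equalities between counts in conditions
-- (2), (4) and (5) into statements about single vertices and edges.
∑-≤-≡ : ∀ (xs : List A) {f g : A → ℕ} → (∀ x → f x ≤ g x) → ∑ xs f ≡ ∑ xs g →
        ∀ {x} → x ∈ xs → f x ≡ g x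
∑-≤-≡ (y ∷ ys) {f} {g} f≤g e (here refl) = ≤-antisym (f≤g y) (+-cancelʳ-≤ (∑ ys g) (g y) (f y)
  (≤-trans (≤-reflexive (sym e)) (+-monoʳ-≤ (f y) (∑-mono ys f≤g))))
∑-≤-≡ (y ∷ ys) {f} {g} f≤g e (there x∈) = ∑-≤-≡ ys f≤g (≤-antisym (∑-mono ys f≤g)
  (+-cancelˡ-≤ (f y) _ _ (≤-trans (+-monoˡ-≤ (∑ ys g) (f≤g y)) (≤-reflexive (sym e))))) x∈

∈⇒≤∑ : ∀ (xs : List A) (f : A → ℕ) {x} → x ∈ xs → f x ≤ ∑ xs f
∈⇒≤∑ (y ∷ ys) f (here refl) = m≤m+n (f y) _
∈⇒≤∑ (y ∷ ys) f (there x∈)  = ≤-trans (∈⇒≤∑ ys f x∈) (m≤n+m _ (f y))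

∑≢0⇒∃ : ∀ (xs : List A) (f : A → ℕ) → ∑ xs f ≢ 0 → ∃[ x ] f x ≢ 0
∑≢0⇒∃ []       f ne = contradiction refl ne
∑≢0⇒∃ (x ∷ xs) f ne with f x ≟ 0
... | no fx≢0 = x , fx≢0
... | yes fx≡0 = ∑≢0⇒∃ xs f (λ e → ne (cong₂ _+_ fx≡0 e))

∑-0 : ∀ (xs : List A) {f : A → ℕ} → (∀ x → f x ≡ 0) → ∑ xs f ≡ 0
∑-0 xs e = trans (∑-cong xs e) (trans (∑-const xs 0) (*-zeroʳ (length xs)))

∑-0-∈ : ∀ (xs : List A) {f : A → ℕ} → (∀ {x} → x ∈ xs → f x ≡ 0) → ∑ xs f ≡ 0
∑-0-∈ xs e = trans (∑-cong-∈ xs e) (∑-0 xs (λ _ → refl))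

∑-δ : ∀ {xs : List (Fin n)} {v} → Unique xs → v ∈ xs → ∑[ x ∈ xs ] ⟦ x Fin.≟ v ⟧ ≡ 1
∑-δ {xs = x ∷ xs} {v} (x∉ ∷ u) (here refl) =
  cong₂ _+_ (⟦⟧-yes (x Fin.≟ x) refl)
            (∑-0-∈ xs (λ {y} y∈ → ⟦⟧-no (y Fin.≟ x) (λ e → All.lookup x∉ y∈ (sym e))))
∑-δ {xs = x ∷ xs} {v} (x∉ ∷ u) (there v∈) =
  cong₂ _+_ (⟦⟧-no (x Fin.≟ v) (All.lookup x∉ v∈)) (∑-δ u v∈)

V : ∀ n → List (Fin n)
V = allFin

∑V-1 : ∀ n → ∑[ _ ∈ V n ] 1 ≡ n
∑V-1 n = trans (∑-const (V n) 1) (trans (*-identityʳ _) (length-tabulate {n = n} id))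

∑V-δ : (v : Fin n) → ∑[ x ∈ V n ] ⟦ x Fin.≟ v ⟧ ≡ 1
∑V-δ {n} v = ∑-δ (Unique.allFin⁺ n) (∈-allFin v)

∑V-suc : (f : Fin (suc n) → ℕ) → ∑ (V (suc n)) f ≡ f zero + ∑ (V n) (f ∘ suc)
∑V-suc {n} f = cong (f zero +_)
  (trans (cong sum (map-tabulate suc f)) (sym (cong sum (map-tabulate id (f ∘ suc)))))

-- Double counting of the pairs of an entry and a vertex that coincide: every entry has one such
-- vertex, every vertex at most one such entry.
Unique⇒length≤ : ∀ {xs : List (Fin n)} → Unique xs → length xs ≤ n
Unique⇒length≤ {n} {xs} u = begin
  length xs                              ≡⟨ *-identityʳ _ ⟨
  length xs * 1                          ≡⟨ ∑-const xs 1 ⟨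
  ∑[ _ ∈ xs ] 1                          ≡⟨ ∑-cong xs (λ x → sym (∑V-δ x)) ⟩
  ∑[ x ∈ xs ] ∑[ v ∈ V n ] ⟦ v Fin.≟ x ⟧  ≡⟨ ∑-swap xs (V n) _ ⟩
  ∑[ v ∈ V n ] ∑[ x ∈ xs ] ⟦ v Fin.≟ x ⟧  ≤⟨ ∑-mono (V n) bound ⟩
  ∑[ _ ∈ V n ] 1                         ≡⟨ ∑V-1 n ⟩
  n                                      ∎
  where
  open ≤-Reasoning
  open import Data.List.Membership.DecPropositional (Fin._≟_ {n}) using (_∈?_)
  sym-δ : ∀ v x → ⟦ v Fin.≟ x ⟧ ≡ ⟦ x Fin.≟ v ⟧
  sym-δ v x = ⟦⟧-cong (v Fin.≟ x) (x Fin.≟ v) sym sym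
  bound : ∀ v → ∑[ x ∈ xs ] ⟦ v Fin.≟ x ⟧ ≤ 1
  bound v with v ∈? xs
  ... | yes v∈ = ≤-reflexive (trans (∑-cong xs (sym-δ v)) (∑-δ u v∈))
  ... | no v∉  = ≤-trans (≤-reflexive (∑-0-∈ xs (λ {x} x∈ → ⟦⟧-no (v Fin.≟ x) (λ { refl → v∉ x∈ })))) z≤n

-- Sums over arcs

module ArcSums {n} (G : SimpleGraph n) where
  open SimpleGraph G

  -- An arc is an ordered adjacent pair. Unlike `edges`, which orders the ends by index, arcs are
  -- symmetric in their ends; `handshake` passes between the two at the cost of a factor 2.
  ∑arcs : (Fin n → Fin n → ℕ) → ℕ
  ∑arcs f = ∑[ u ∈ V n ] ∑[ w ∈ V n ] ⟦ adj? u w ⟧ * f u w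

  degree≡∑ : ∀ u → degree G u ≡ ∑[ w ∈ V n ] ⟦ adj? u w ⟧
  degree≡∑ u = length-filter≡∑ (adj? u) (V n)

  ∑arcs-cong : ∀ {f g} → (∀ {u w} → Adj u w → f u w ≡ g u w) → ∑arcs f ≡ ∑arcs g
  ∑arcs-cong e = ∑-cong (V n) λ u → ∑-cong (V n) λ w → ⟦⟧*-cong (adj? u w) e

  ∑arcs-+ : ∀ (f g : Fin n → Fin n → ℕ) → ∑arcs (λ u w → f u w + g u w) ≡ ∑arcs f + ∑arcs g
  ∑arcs-+ f g =
    trans (∑-cong (V n) λ u → trans (∑-cong (V n) λ w → *-distribˡ-+ ⟦ adj? u w ⟧ (f u w) (g u w))
                                    (∑-+ (V n) _ _))
          (∑-+ (V n) _ _)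

  ∑arcs-swap : ∀ (f : Fin n → Fin n → ℕ) → ∑arcs f ≡ ∑arcs (λ u w → f w u)
  ∑arcs-swap f =
    trans (∑-swap (V n) (V n) _)
          (∑-cong (V n) λ w → ∑-cong (V n) λ u →
            cong (_* f u w) (⟦⟧-cong (adj? u w) (adj? w u) symm symm))

  ∑arcs-source : ∀ (g : Fin n → ℕ) → ∑arcs (λ u _ → g u) ≡ ∑[ u ∈ V n ] degree G u * g u
  ∑arcs-source g = ∑-cong (V n) λ u →
    trans (∑-*ʳ (V n) (g u) _) (cong (_* g u) (sym (degree≡∑ u)))

  -- A vertex is the source of as many arcs as its degree, and the target of equally many.
  ∑arcs-endpoints : ∀ (g : Fin n → ℕ) → ∑arcs (λ u w → g u + g w) ≡ 2 * (∑[ u ∈ V n ] degree G u * g u)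
  ∑arcs-endpoints g = begin
    ∑arcs (λ u w → g u + g w)                  ≡⟨ ∑arcs-+ (λ u _ → g u) (λ _ w → g w) ⟩
    S + ∑arcs (λ _ w → g w)                    ≡⟨ cong (S +_) (∑arcs-swap (λ _ w → g w)) ⟩
    S + S                                      ≡⟨ cong (S +_) (+-identityʳ S) ⟨
    2 * S                                      ≡⟨ cong (2 *_) (∑arcs-source g) ⟩
    2 * (∑[ u ∈ V n ] degree G u * g u)        ∎
    where
    open ≡-Reasoning
    S = ∑arcs (λ u _ → g u)

  ∑edges : ∀ (f : Fin n × Fin n → ℕ) →
           ∑ (edges G) f ≡ ∑[ u ∈ V n ] ∑[ w ∈ V n ] ⟦ (u Fin.<? w) ×-dec adj? u w ⟧ * f (u , w)
  ∑edges f = trans (∑-filter _ (cartesianProduct (V n) (V n)) f) (∑-cartesianProduct (V n) (V n) _)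

  -- The arcs split according to which end has the smaller index, and the symmetry of `f` makes the
  -- two halves equal.
  handshake : ∀ f → (∀ u w → f u w ≡ f w u) → ∑arcs f ≡ 2 * ∑ (edges G) (uncurry f)
  handshake f f-symm = begin
    ∑arcs f
      ≡⟨ (∑-cong (V n) λ u → ∑-cong (V n) λ w →
           trans (cong (_* f u w) (split u w)) (*-distribʳ-+ (f u w) (lt u w) (lt w u))) ⟩
    ∑[ u ∈ V n ] ∑[ w ∈ V n ] (lt u w * f u w + lt w u * f u w)
      ≡⟨ trans (∑-cong (V n) λ u → ∑-+ (V n) _ _) (∑-+ (V n) _ _) ⟩
    (∑[ u ∈ V n ] ∑[ w ∈ V n ] lt u w * f u w) + (∑[ u ∈ V n ] ∑[ w ∈ V n ] lt w u * f u w)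
      ≡⟨ cong₂ _+_ (sym (∑edges (uncurry f))) back ⟩
    E + E
      ≡⟨ cong (E +_) (sym (+-identityʳ E)) ⟩
    2 * E ∎
    where
    open ≡-Reasoning
    E = ∑ (edges G) (uncurry f)
    lt? : ∀ u w → Dec (u Fin.< w × Adj u w)
    lt? u w = (u Fin.<? w) ×-dec adj? u w
    lt : Fin n → Fin n → ℕ
    lt u w = ⟦ lt? u w ⟧
    back : ∑[ u ∈ V n ] ∑[ w ∈ V n ] lt w u * f u w ≡ E
    back = trans (∑-swap (V n) (V n) _)
      (trans (∑-cong (V n) λ w → ∑-cong (V n) λ u → cong (lt w u *_) (f-symm u w)) (sym (∑edges (uncurry f))))
    oriented : ∀ {u w} (a : Dec (Adj u w)) (d : Dec (u Fin.< w × Adj u w)) (e : Dec (w Fin.< u × Adj w u)) →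
               ⟦ a ⟧ ≡ ⟦ d ⟧ + ⟦ e ⟧
    oriented (no ¬a) d e = sym (cong₂ _+_ (⟦⟧-no d (¬a ∘ proj₂)) (⟦⟧-no e (¬a ∘ symm ∘ proj₂)))
    oriented {u} {w} (yes a) d e with Fin.<-cmp u w
    ... | tri< u<w _ w≮u = sym (cong₂ _+_ (⟦⟧-yes d (u<w , a)) (⟦⟧-no e (w≮u ∘ proj₁)))
    ... | tri≈ _ u≡w _   = contradiction a (irrefl u≡w)
    ... | tri> u≮w _ w<u = sym (cong₂ _+_ (⟦⟧-no d (u≮w ∘ proj₁)) (⟦⟧-yes e (w<u , symm a)))
    split : ∀ u w → ⟦ adj? u w ⟧ ≡ lt u w + lt w u
    split u w = oriented (adj? u w) (lt? u w) (lt? w u)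

  between? : ∀ i j (u w : Fin n) → Dec ((degree G u ≡ i × degree G w ≡ j) ⊎ (degree G u ≡ j × degree G w ≡ i))
  between? i j u w = ((degree G u ≟ i) ×-dec (degree G w ≟ j)) ⊎-dec ((degree G u ≟ j) ×-dec (degree G w ≟ i))

  2*#edge : ∀ i j → 2 * #edge G i j ≡ ∑arcs (λ u w → ⟦ between? i j u w ⟧)
  2*#edge i j = trans (cong (2 *_) (length-filter≡∑ _ (edges G)))
    (sym (handshake _ λ u w → ⟦⟧-cong (between? i j u w) (between? i j w u) flip flip))
    where
    flip : {A B C D : Set} → (A × B) ⊎ (C × D) → (D × C) ⊎ (B × A)
    flip = [ (λ (a , b) → inj₂ (b , a)) , (λ (c , d) → inj₁ (d , c)) ]

  2*#edge-same : ∀ i → 2 * #edge G i i ≡ ∑arcs (λ u w → ⟦ degree G u ≟ i ⟧ * ⟦ degree G w ≟ i ⟧)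
  2*#edge-same i = trans (2*#edge i i) (∑arcs-cong λ {u} {w} _ →
    trans (⟦⟧-cong (between? i i u w) ((degree G u ≟ i) ×-dec (degree G w ≟ i)) [ id , id ] inj₁)
          (⟦⟧-× (degree G u ≟ i) (degree G w ≟ i)))

  -- For different degrees just one of the two arcs of a counted edge runs from degree `i` to degree
  -- `j`, so the factor 2 of `2*#edge-same` disappears.
  #edge-distinct : ∀ {i j} → i ≢ j →
    #edge G i j ≡ ∑arcs (λ u w → ⟦ degree G u ≟ i ⟧ * ⟦ degree G w ≟ j ⟧)
  #edge-distinct {i} {j} i≢j = *-cancelˡ-≡ _ _ 2 (begin
    2 * #edge G i j                          ≡⟨ 2*#edge i j ⟩
    ∑arcs (λ u w → ⟦ between? i j u w ⟧)     ≡⟨ ∑arcs-cong (λ {u} {w} _ → split u w) ⟩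
    ∑arcs (λ u w → f u w + f w u)            ≡⟨ ∑arcs-+ f (λ u w → f w u) ⟩
    ∑arcs f + ∑arcs (λ u w → f w u)          ≡⟨ cong (∑arcs f +_) (trans (sym (∑arcs-swap f)) (sym (+-identityʳ _))) ⟩
    2 * ∑arcs f                              ∎)
    where
    open ≡-Reasoning
    f : Fin n → Fin n → ℕ
    f u w = ⟦ degree G u ≟ i ⟧ * ⟦ degree G w ≟ j ⟧
    dec : ∀ u w → Dec (degree G u ≡ i × degree G w ≡ j)
    dec u w = (degree G u ≟ i) ×-dec (degree G w ≟ j)
    split : ∀ u w → ⟦ between? i j u w ⟧ ≡ f u w + f w u
    split u w = trans (lemma (dec u w) (dec w u))
      (cong₂ _+_ (⟦⟧-× (degree G u ≟ i) (degree G w ≟ j)) (⟦⟧-× (degree G w ≟ i) (degree G u ≟ j)))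
      where
      lemma : (d : Dec (degree G u ≡ i × degree G w ≡ j)) (e : Dec (degree G w ≡ i × degree G u ≡ j)) →
              ⟦ between? i j u w ⟧ ≡ ⟦ d ⟧ + ⟦ e ⟧
      lemma (yes (p , _)) (yes (_ , q)) = contradiction (trans (sym p) q) i≢j
      lemma (yes p) (no _) = ⟦⟧-yes (between? i j u w) (inj₁ p)
      lemma (no _) (yes (p , q)) = ⟦⟧-yes (between? i j u w) (inj₂ (q , p))
      lemma (no ¬p) (no ¬q) = ⟦⟧-no (between? i j u w) [ ¬p , (λ (q , p) → ¬q (p , q)) ]

  #deg≡∑ : ∀ i → #deg G i ≡ ∑[ v ∈ V n ] ⟦ degree G v ≟ i ⟧
  #deg≡∑ i = length-filter≡∑ _ (V n)

  ∑arcs-ofDegree : ∀ a → ∑arcs (λ u _ → ⟦ degree G u ≟ a ⟧) ≡ a * #deg G a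
  ∑arcs-ofDegree a = begin
    ∑arcs (λ u _ → ⟦ degree G u ≟ a ⟧)               ≡⟨ ∑arcs-source (λ u → ⟦ degree G u ≟ a ⟧) ⟩
    ∑[ u ∈ V n ] degree G u * ⟦ degree G u ≟ a ⟧     ≡⟨ ∑-cong (V n) (λ u → on-degree (degree G u ≟ a)) ⟩
    ∑[ u ∈ V n ] a * ⟦ degree G u ≟ a ⟧              ≡⟨ ∑-*ˡ (V n) a (λ u → ⟦ degree G u ≟ a ⟧) ⟩
    a * (∑[ u ∈ V n ] ⟦ degree G u ≟ a ⟧)            ≡⟨ cong (a *_) (#deg≡∑ a) ⟨
    a * #deg G a                                     ∎
    where
    open ≡-Reasoning
    on-degree : ∀ {x} (e : Dec (x ≡ a)) → x * ⟦ e ⟧ ≡ a * ⟦ e ⟧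
    on-degree (yes refl) = refl
    on-degree {x} (no _) = trans (*-zeroʳ x) (sym (*-zeroʳ a))

  mid? : ∀ Δ d → Dec (3 ≤ d × d < Δ)
  mid? Δ d = (3 ≤? d) ×-dec (d <? Δ)

  Σ#deg≡∑ : ∀ {Δ} → 3 ≤ Δ → Σ#deg G Δ ≡ ∑[ v ∈ V n ] ⟦ mid? Δ (degree G v) ⟧
  Σ#deg≡∑ {Δ} 3≤Δ = trans (go (Δ ∸ 3) 3) (∑-cong (V n) λ v → ⟦⟧-cong (between (Δ ∸ 3) 3 v) (mid? Δ (degree G v))
     (λ (p , q) → p , subst (degree G v <_) (m+[n∸m]≡n 3≤Δ) q)
     (λ (p , q) → p , subst (degree G v <_) (sym (m+[n∸m]≡n 3≤Δ)) q))
    where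
    between : ∀ l s v → Dec (s ≤ degree G v × degree G v < s + l)
    between l s v = (s ≤? degree G v) ×-dec (degree G v <? s + l)
    -- Start and length of the interval of degrees are generalised, so that the induction can split
    -- off the smallest degree `s`.
    go : ∀ l s → sum (applyUpTo (λ i → #deg G (s + i)) l) ≡ ∑[ v ∈ V n ] ⟦ between l s v ⟧
    go zero s = sym (∑-0 (V n) λ v → ⟦⟧-no (between 0 s v) λ (p , q) → <⇒≱ q (subst (_≤ degree G v) (sym (+-identityʳ s)) p))
    go (suc l) s = trans (cong₂ _+_ (trans (cong (#deg G) (+-identityʳ s)) (#deg≡∑ s))
        (trans (cong sum (applyUpTo-cong l (λ i → cong (#deg G) (+-suc s i)))) (go l (suc s))))
      (trans (sym (∑-+ (V n) _ _)) (∑-cong (V n) λ v → step v))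
      where
      applyUpTo-cong : ∀ l {f g : ℕ → ℕ} → (∀ i → f i ≡ g i) → applyUpTo f l ≡ applyUpTo g l
      applyUpTo-cong zero    e = refl
      applyUpTo-cong (suc l) e = cong₂ _∷_ (e 0) (applyUpTo-cong l (e ∘ suc))
      first : ∀ {d} (e : Dec (d ≡ s)) (b : Dec (suc s ≤ d × d < suc s + l)) (c : Dec (s ≤ d × d < s + suc l)) →
              ⟦ e ⟧ + ⟦ b ⟧ ≡ ⟦ c ⟧
      first (yes refl) b c = trans (cong suc (⟦⟧-no b (λ (p , _) → <-irrefl refl p))) (sym (⟦⟧-yes c (≤-refl , m<m+n s z<s)))
      first {d} (no d≢s) b c = ⟦⟧-cong b c
               (λ (p , q) → <⇒≤ p , subst (d <_) (sym (+-suc s l)) q)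
               (λ (p , q) → ≤∧≢⇒< p (d≢s ∘ sym) , subst (d <_) (+-suc s l) q)
      step : ∀ v → ⟦ degree G v ≟ s ⟧ + ⟦ between l (suc s) v ⟧ ≡ ⟦ between (suc l) s v ⟧
      step v = first (degree G v ≟ s) (between l (suc s) v) (between (suc l) s v)

  leaf-neighbour-unique : ∀ u {v w} → Adj u v → Adj u w → degree G u ≤ 1 → v ≡ w
  leaf-neighbour-unique u {v} {w} uv uw d≤1 with v Fin.≟ w
  ... | yes e = e
  ... | no v≢w = contradiction d≤1 (<⇒≱ (begin
    2                                                       ≡⟨ cong₂ _+_ (∑V-δ v) (∑V-δ w) ⟨
    (∑[ x ∈ V n ] ⟦ x Fin.≟ v ⟧) + (∑[ x ∈ V n ] ⟦ x Fin.≟ w ⟧)  ≡⟨ ∑-+ (V n) _ _ ⟨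
    ∑[ x ∈ V n ] (⟦ x Fin.≟ v ⟧ + ⟦ x Fin.≟ w ⟧)             ≤⟨ ∑-mono (V n) bound ⟩
    ∑[ x ∈ V n ] ⟦ adj? u x ⟧                               ≡⟨ degree≡∑ u ⟨
    degree G u                                              ∎))
    where
    open ≤-Reasoning
    bound : ∀ x → ⟦ x Fin.≟ v ⟧ + ⟦ x Fin.≟ w ⟧ ≤ ⟦ adj? u x ⟧
    bound x with x Fin.≟ v | x Fin.≟ w
    ... | yes refl | yes e    = contradiction e v≢w
    ... | yes refl | no _     = ≤-reflexive (sym (⟦⟧-yes (adj? u x) uv))
    ... | no _     | yes refl = ≤-reflexive (sym (⟦⟧-yes (adj? u x) uw))
    ... | no _     | no _     = z≤n

  Adj⇒1≤degree : ∀ {u w} → Adj u w → 1 ≤ degree G u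
  Adj⇒1≤degree {u} {w} a = subst₂ _≤_ (⟦⟧-yes (adj? u w) a) (sym (degree≡∑ u))
    (∈⇒≤∑ (V n) (λ w → ⟦ adj? u w ⟧) (∈-allFin w))

  #nonleafNeighbours : Fin n → ℕ
  #nonleafNeighbours v = length (filter (λ w → adj? v w ×-dec (1 <? degree G w)) (allFin n))

  #nonleafNeighbours≡∑ : ∀ v → #nonleafNeighbours v ≡ ∑[ w ∈ V n ] ⟦ adj? v w ×-dec (1 <? degree G w) ⟧
  #nonleafNeighbours≡∑ v = length-filter≡∑ _ (V n)

-- Trees have n - 1 edges

module TreeSize {n} (G : SimpleGraph n) where
  open SimpleGraph G
  open ArcSums G
  open import Data.List.Membership.DecPropositional (Fin._≟_ {n}) using (_∈?_)

  AdjAvoiding : Fin n → Fin n → Fin n → Set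
  AdjAvoiding w x y = Adj x y × x ≢ w × y ≢ w

  -- Simple paths avoiding `w`, indexed by their vertex list: if the ends are distinct neighbours of
  -- `w`, then `w` followed by this list is an `IsCycle`.
  data Path (w : Fin n) : Fin n → Fin n → List (Fin n) → Set where
    stop : ∀ {y} → y ≢ w → Path w y y (y ∷ [])
    step : ∀ {x x′ y vs} → x ≢ w → Adj x x′ → x ∉ vs → Path w x′ y vs → Path w x y (x ∷ vs)

  suffixFrom : ∀ {w x y z vs} → z ∈ vs → Path w x y vs → ∃ (Path w z y)
  suffixFrom (here refl) p                 = _ , extract p
    where
    extract : ∀ {w x y z vs} → Path w x y (z ∷ vs) → Path w z y (z ∷ vs)
    extract p@(stop _)       = p
    extract p@(step _ _ _ _) = p
  suffixFrom (there z∈)  (step _ _ _ p)    = suffixFrom z∈ p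

  -- If the first vertex recurs on the path built from the rest of the walk, everything before the
  -- recurrence is dropped.
  loopErasure : ∀ {w x y} → x ≢ w → Star (AdjAvoiding w) x y → ∃ (Path w x y)
  loopErasure x≢w ε = _ , stop x≢w
  loopErasure {x = x} x≢w ((a , _ , x′≢w) ◅ s) with loopErasure x′≢w s
  ... | vs , p with x ∈? vs
  ...   | yes x∈ = suffixFrom x∈ p
  ...   | no x∉  = x ∷ vs , step x≢w a x∉ p

  Path-unique : ∀ {w x y vs} → Path w x y vs → Unique vs
  Path-unique (stop _)        = [] ∷ []
  Path-unique (step _ _ x∉ p) = ¬Any⇒All¬ _ x∉ ∷ Path-unique p

  Path-avoids : ∀ {w x y vs} → Path w x y vs → All (w ≢_) vs
  Path-avoids (stop ne)       = (ne ∘ sym) ∷ []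
  Path-avoids (step ne _ _ p) = (ne ∘ sym) ∷ Path-avoids p

  Path-linked : ∀ {w x y u vs} → Adj u x → Adj y w → Path w x y vs → Linked Adj (u ∷ (vs ∷ʳ w))
  Path-linked ux yw (stop _)       = ux ∷ yw ∷ [-]
  Path-linked ux yw (step _ a _ p) = ux ∷ Path-linked a yw p

  module _ (acyclic : ∀ u vs → ¬ IsCycle G u vs) where

    -- A walk between two neighbours of w that avoids w would close up to a cycle through w.
    noDetour : ∀ {w x y} → Adj w x → Adj w y → Star (AdjAvoiding w) x y → x ≡ y
    noDetour {w} {x} {y} wx wy s with loopErasure (λ x≡w → irrefl (sym x≡w) wx) s
    ... | _ , stop _ = refl
    ... | _ , p@(step _ _ _ q) = contradiction
      (record { long = s≤s (nonempty q); distinct = Path-avoids p ∷ Path-unique p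
              ; closed = Path-linked wx (symm wy) p })
      (acyclic w _)
      where
      nonempty : ∀ {w x y vs} → Path w x y vs → 1 ≤ length vs
      nonempty (stop _)       = s≤s z≤n
      nonempty (step _ _ _ _) = s≤s z≤n

    -- Grown by one adjacent vertex at a time, newest first, so that edges can be counted by
    -- induction on the growth.
    data Subtree : List (Fin n) → Set where
      seed : ∀ r → Subtree (r ∷ [])
      grow : ∀ {S v w} → Subtree S → w ∉ S → v ∈ S → Adj w v → Subtree (w ∷ S)

    Subtree-unique : ∀ {S} → Subtree S → Unique S
    Subtree-unique (seed r)          = [] ∷ []
    Subtree-unique (grow t w∉ _ _) = ¬Any⇒All¬ _ w∉ ∷ Subtree-unique t

    -- Each vertex was joined to one already present, so the connecting walk stays inside `S` and
    -- thereby avoids the outside vertex `w`.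
    Subtree-connected : ∀ {S w x y} → Subtree S → w ∉ S → x ∈ S → y ∈ S → Star (AdjAvoiding w) x y
    Subtree-connected (seed r) _ (here refl) (here refl) = ε
    Subtree-connected (grow _ _ _ _) _ (here refl) (here refl) = ε
    Subtree-connected (grow t _ v∈ a) w∉ (here refl) (there y∈) =
      (a , (λ e → w∉ (here (sym e))) , (λ e → w∉ (there (subst (_∈ _) e v∈))))
        ◅ Subtree-connected t (w∉ ∘ there) v∈ y∈
    Subtree-connected (grow t _ v∈ a) w∉ (there x∈) (here refl) =
      Subtree-connected t (w∉ ∘ there) x∈ v∈
        ◅◅ (symm a , (λ e → w∉ (there (subst (_∈ _) e v∈))) , (λ e → w∉ (here (sym e)))) ◅ ε
    Subtree-connected (grow t _ _ _) w∉ (there x∈) (there y∈) =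
      Subtree-connected t (w∉ ∘ there) x∈ y∈

    -- A new vertex has only one neighbour in `S`: two would be connected inside `S`, a detour
    -- excluded by `noDetour`. Hence each growth step adds two arcs. The summand 2 stands on the
    -- left to avoid subtraction.
    Subtree-size : ∀ {S} → Subtree S → (∑[ x ∈ S ] ∑[ y ∈ S ] ⟦ adj? x y ⟧) + 2 ≡ 2 * length S
    Subtree-size (seed r) = cong (λ a → a + 0 + 0 + 2) (⟦⟧-no (adj? r r) (irrefl refl))
    Subtree-size {w ∷ S} (grow {v = v} t w∉ v∈ a) = begin
      (⟦ adj? w w ⟧ + row) + (∑[ x ∈ S ] (⟦ adj? x w ⟧ + inner x)) + 2
        ≡⟨ cong₂ (λ p q → p + q + 2) (cong₂ _+_ (⟦⟧-no (adj? w w) (irrefl refl)) row≡1)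
             (trans (∑-+ S (λ x → ⟦ adj? x w ⟧) inner)
                    (cong (_+ ∑ S inner) (trans (∑-cong S λ x → ⟦⟧-cong (adj? x w) (adj? w x) symm symm) row≡1))) ⟩
      1 + (1 + ∑ S inner) + 2      ≡⟨ cong (2 +_) (Subtree-size t) ⟩
      2 + 2 * length S             ≡⟨ *-suc 2 (length S) ⟨
      2 * length (w ∷ S)           ∎
      where
      open ≡-Reasoning
      row = ∑[ y ∈ S ] ⟦ adj? w y ⟧
      inner : Fin n → ℕ
      inner x = ∑[ y ∈ S ] ⟦ adj? x y ⟧
      row≡1 : row ≡ 1
      row≡1 = trans
        (∑-cong-∈ S λ {y} y∈ → ⟦⟧-cong (adj? w y) (y Fin.≟ v)
          (λ wy → noDetour wy a (Subtree-connected t w∉ y∈ v∈)) (λ { refl → a }))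
        (∑-δ (Subtree-unique t) v∈)

    module _ (connected : ∀ u v → Star Adj u v) where

      crossing : ∀ {S x y} → x ∈ S → y ∉ S → Star Adj x y → ∃[ v ] ∃[ w ] v ∈ S × w ∉ S × Adj w v
      crossing x∈ y∉ ε = contradiction x∈ y∉
      crossing {S} x∈ y∉ (_◅_ {j = z} a s) with z ∈? S
      ... | yes z∈ = crossing z∈ y∉ s
      ... | no z∉  = _ , z , x∈ , z∉ , symm a

      -- While a vertex is missing, a walk from `r` to it leaves `S` along an edge by which `S` can
      -- grow. `fuel` exceeds the number of missing vertices; running out of it would give a
      -- duplicate-free list of more than `n` vertices.
      spanning : ∀ r fuel {S} → Subtree S → r ∈ S → n < length S + fuel →
                 ∃[ S ] Subtree S × (∀ u → u ∈ S)
      spanning r zero t r∈ n< =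
        contradiction (≤-trans n< (≤-trans (≤-reflexive (+-identityʳ _)) (Unique⇒length≤ (Subtree-unique t)))) (<-irrefl refl)
      spanning r (suc fuel) {S} t r∈ n< with Fin.any? (λ u → ¬? (u ∈? S))
      ... | no ¬∃ = S , t , λ u → decidable-stable (u ∈? S) (λ u∉ → ¬∃ (u , u∉))
      ... | yes (u , u∉) with crossing r∈ u∉ (connected r u)
      ...   | v , w , v∈ , w∉ , a =
        spanning r fuel (grow t w∉ v∈ a) (there r∈) (subst (n <_) (+-suc (length S) fuel) n<)

  ∑degree-tree : IsTree G → ∑ (V n) (degree G) + 2 ≡ 2 * n
  ∑degree-tree tree = begin
    ∑ (V n) (degree G) + 2                        ≡⟨ cong (_+ 2) (∑-cong (V n) degree≡∑) ⟩
    (∑[ x ∈ V n ] ∑[ y ∈ V n ] ⟦ adj? x y ⟧) + 2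
      ≡⟨ cong (_+ 2) (∑-cong (V n) λ x → ∑-↭ (λ y → ⟦ adj? x y ⟧) (↭-sym S↭V)) ⟩
    (∑[ x ∈ V n ] ∑[ y ∈ S ] ⟦ adj? x y ⟧) + 2    ≡⟨ cong (_+ 2) (∑-↭ (λ x → ∑[ y ∈ S ] ⟦ adj? x y ⟧) (↭-sym S↭V)) ⟩
    (∑[ x ∈ S ] ∑[ y ∈ S ] ⟦ adj? x y ⟧) + 2      ≡⟨ Subtree-size acyclic (proj₁ (proj₂ span)) ⟩
    2 * length S                                  ≡⟨ cong (2 *_) (trans (↭.↭-length S↭V) (length-tabulate {n = n} id)) ⟩
    2 * n                                         ∎
    where
    open ≡-Reasoning
    open IsTree tree
    r : Fin n
    r = Fin.fromℕ< nonempty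
    span : ∃[ S ] Subtree acyclic S × (∀ u → u ∈ S)
    span = spanning acyclic connected r n (seed r) (here refl) ≤-refl
    S : List (Fin n)
    S = proj₁ span
    S↭V : S ↭ V n
    S↭V = ∼bag⇒↭ (unique∧set⇒bag (Subtree-unique acyclic (proj₁ (proj₂ span))) (Unique.allFin⁺ n)
      (λ {x} → mk⇔ (λ _ → ∈-allFin x) (λ _ → proj₂ (proj₂ span) x)))

  -- For d ≥ 1 truncated subtraction gives d + ⟦ d ≟ 1 ⟧ = 2 + (d ∸ 2). Summing over the vertices
  -- and comparing with the degree sum 2 n - 2 leaves the claim.
  leafCount : IsTree G → (∀ v → 1 ≤ degree G v) →
              ∑[ v ∈ V n ] ⟦ degree G v ≟ 1 ⟧ ≡ 2 + (∑[ v ∈ V n ] (degree G v ∸ 2))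
  leafCount tree 1≤d = +-cancelˡ-≡ (∑ (V n) (degree G)) _ _ (begin
    ∑ (V n) (degree G) + (∑[ v ∈ V n ] ⟦ degree G v ≟ 1 ⟧)  ≡⟨ ∑-+ (V n) (degree G) (λ v → ⟦ degree G v ≟ 1 ⟧) ⟨
    ∑[ v ∈ V n ] (degree G v + ⟦ degree G v ≟ 1 ⟧)        ≡⟨ ∑-cong (V n) (λ v → pointwise (degree G v) (1≤d v)) ⟩
    ∑[ v ∈ V n ] (2 * 1 + (degree G v ∸ 2))        ≡⟨ ∑-+ (V n) (λ _ → 2 * 1) (λ v → degree G v ∸ 2) ⟩
    (∑[ v ∈ V n ] 2 * 1) + X                ≡⟨ cong (_+ X) (trans (∑-*ˡ (V n) 2 (λ _ → 1)) (cong (2 *_) (∑V-1 n))) ⟩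
    2 * n + X                               ≡⟨ cong (_+ X) (∑degree-tree tree) ⟨
    ∑ (V n) (degree G) + 2 + X                       ≡⟨ +-assoc (∑ (V n) (degree G)) 2 X ⟩
    ∑ (V n) (degree G) + (2 + X)                     ∎)
    where
    open ≡-Reasoning
    X = ∑[ v ∈ V n ] (degree G v ∸ 2)
    pointwise : ∀ x → 1 ≤ x → x + ⟦ x ≟ 1 ⟧ ≡ 2 * 1 + (x ∸ 2)
    pointwise 1             _ = refl
    pointwise (suc (suc x)) _ = +-identityʳ _

-- Edge types determine σ from the degrees

-- The shape of the edges, up to orientation, in a member of 𝒯′.
data EdgeType (Δ : ℕ) : ℕ → ℕ → Set where
  leaf : EdgeType Δ 1 Δ
  two  : ∀ {d} → 2 ≤ d → EdgeType Δ 2 d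

EdgesTyped : SimpleGraph n → ℕ → Set
EdgesTyped G Δ = ∀ {u w} → Adj u w →
  EdgeType Δ (degree G u) (degree G w) ⊎ EdgeType Δ (degree G w) (degree G u)
  where open SimpleGraph G

-- Apart from leaves and vertices of degree 2 there are k vertices of degree Δ and one of degree j;
-- for j ≤ 2 the last term vanishes and there is no further vertex.
DegreeProfile : SimpleGraph n → (Δ k j : ℕ) → Set
DegreeProfile {n} G Δ k j = ∀ (F : ℕ → ℕ) → F 1 ≡ 0 → F 2 ≡ 0 →
  ∑[ v ∈ V n ] F (degree G v) ≡ k * F Δ + F j

-- Leaves contribute 1 + 2 (Δ - 2) each, any other vertex d (d - 2)²; the number of leaves is 2 + ∑ (d ∸ 2).
σ-value : (Δ k j : ℕ) → ℕ
σ-value Δ k j = (2 + (k * (Δ ∸ 2) + (j ∸ 2))) * (1 + 2 * (Δ ∸ 2))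
              + (k * (Δ * ((Δ ∸ 2) * (Δ ∸ 2))) + j * ((j ∸ 2) * (j ∸ 2)))

square-difference : ∀ a c → (ℤ.+ a ℤ.- ℤ.+ (a + c)) ℤ.^ 2 ≡ ℤ.+ (c * c)
square-difference a c = trans (cong (λ z → (ℤ.+ a ℤ.- z) ℤ.^ 2) (ℤ.pos-+ a c))
  (trans (lemma (ℤ.+ a) (ℤ.+ c)) (sym (ℤ.pos-* c c)))
  where
  lemma : ∀ x y → (x ℤ.- (x ℤ.+ y)) ℤ.* ((x ℤ.- (x ℤ.+ y)) ℤ.* ℤ.1ℤ) ≡ y ℤ.* y
  lemma = solveℤ-∀

square-difference-comm : ∀ x y → (x ℤ.- y) ℤ.^ 2 ≡ (y ℤ.- x) ℤ.^ 2
square-difference-comm = lemma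
  where
  lemma : ∀ x y → (x ℤ.- y) ℤ.* ((x ℤ.- y) ℤ.* ℤ.1ℤ) ≡ (y ℤ.- x) ℤ.* ((y ℤ.- x) ℤ.* ℤ.1ℤ)
  lemma = solveℤ-∀

-- `σ` is an integer sum of squares; this moves its evaluation to the natural numbers, where all
-- counting takes place.
foldr-pos : ∀ (xs : List A) {g : A → ℤ} {f : A → ℕ} → (∀ {x} → x ∈ xs → g x ≡ ℤ.+ f x) →
            foldr ℤ._+_ 0ℤ (map g xs) ≡ ℤ.+ ∑ xs f
foldr-pos []       e = refl
foldr-pos (x ∷ xs) {f = f} e =
  trans (cong₂ ℤ._+_ (e (here refl)) (foldr-pos xs (e ∘ there))) (sym (ℤ.pos-+ (f x) (∑ xs f)))

module EdgeEquations {n} (G : SimpleGraph n) (tree : IsTree G) {Δ} (3≤Δ : 3 ≤ Δ) (typed : EdgesTyped G Δ) where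
  open SimpleGraph G
  open ArcSums G
  open TreeSize G

  private
    d : Fin n → ℕ
    d = degree G

  -- Each edge has exactly one end of degree ≥ 3, except those counted by m₂₂, which have none.
  big-cover : (∑[ v ∈ V n ] d v * ⟦ 3 ≤? d v ⟧) + #edge G 2 2 + 1 ≡ n
  big-cover = *-cancelˡ-≡ _ _ 2 (begin
    2 * (T + #edge G 2 2 + 1)                 ≡⟨ expand T (#edge G 2 2) ⟩
    2 * T + 2 * #edge G 2 2 + 2               ≡⟨ cong (_+ 2) (cong₂ _+_ (sym (∑arcs-endpoints t)) (2*#edge-same 2)) ⟩
    ∑arcs (λ u w → t u + t w) + ∑arcs b + 2   ≡⟨ cong (_+ 2) (∑arcs-+ (λ u w → t u + t w) b) ⟨
    ∑arcs (λ u w → t u + t w + b u w) + 2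
      ≡⟨ cong (_+ 2) (∑arcs-cong (λ {u} {w} a → [ covered , (λ g → trans (flip u w) (covered g)) ] (typed a))) ⟩
    ∑arcs (λ _ _ → 1) + 2                     ≡⟨ cong (_+ 2) (∑arcs-source (λ _ → 1)) ⟩
    (∑[ v ∈ V n ] d v * 1) + 2                ≡⟨ cong (_+ 2) (∑-cong (V n) (λ v → *-identityʳ (d v))) ⟩
    ∑ (V n) d + 2                             ≡⟨ ∑degree-tree tree ⟩
    2 * n                                     ∎)
    where
    open ≡-Reasoning
    t : Fin n → ℕ
    t v = ⟦ 3 ≤? d v ⟧
    b : Fin n → Fin n → ℕ
    b u w = ⟦ d u ≟ 2 ⟧ * ⟦ d w ≟ 2 ⟧
    T = ∑[ v ∈ V n ] d v * t v
    expand : ∀ x y → 2 * (x + y + 1) ≡ 2 * x + 2 * y + 2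
    expand = solve-∀
    flip : ∀ u w → t u + t w + b u w ≡ t w + t u + b w u
    flip u w = cong₂ _+_ (+-comm (t u) (t w)) (*-comm ⟦ d u ≟ 2 ⟧ ⟦ d w ≟ 2 ⟧)
    covered : ∀ {x y} → EdgeType Δ x y → ⟦ 3 ≤? x ⟧ + ⟦ 3 ≤? y ⟧ + ⟦ x ≟ 2 ⟧ * ⟦ y ≟ 2 ⟧ ≡ 1
    covered leaf = trans (+-identityʳ _) (⟦⟧-yes (3 ≤? Δ) 3≤Δ)
    covered (two {1} (s≤s ()))
    covered (two {2} _) = refl
    covered (two {suc (suc (suc _))} _) = refl

  -- This is (Δ - 1)² - (Δ - 2)², what a leaf edge contributes beyond the potential of its end of
  -- degree Δ.
  leafWeight : ℕ
  leafWeight = 1 + 2 * (Δ ∸ 2)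

  -- Chosen so that (d u - d w)² = h (d u) + h (d w) on every edge.
  h : ℕ → ℕ
  h x = ⟦ x ≟ 1 ⟧ * leafWeight + (x ∸ 2) * (x ∸ 2)

  -- Summing `h` over both ends of every edge counts each vertex once per incident edge.
  σ-potential : σ G ≡ ℤ.+ (∑[ v ∈ V n ] d v * h (d v))
  σ-potential = trans (foldr-pos (edges G) {f = λ (u , w) → h (d u) + h (d w)} onEdge)
    (cong ℤ.+_ (*-cancelˡ-≡ _ _ 2 (trans
      (sym (handshake (λ u w → h (d u) + h (d w)) (λ u w → +-comm (h (d u)) (h (d w)))))
      (∑arcs-endpoints (h ∘ d)))))
    where
    typed-square : ∀ {x y} → EdgeType Δ x y → (ℤ.+ x ℤ.- ℤ.+ y) ℤ.^ 2 ≡ ℤ.+ (h x + h y)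
    typed-square leaf = lemma Δ 3≤Δ
      where
      arith : ∀ e → (1 + e) * (1 + e) ≡ 1 * (1 + 2 * e) + 0 * 0 + e * e
      arith = solve-∀
      -- `Δ` is fixed by the module, so it is generalised to `D` for matching. The right side is
      -- `h 1 + h D` with `h 1` written out; the bracket `⟦ D ≟ 1 ⟧` vanishes once `D` is matched.
      lemma : ∀ D → 3 ≤ D → (ℤ.+ 1 ℤ.- ℤ.+ D) ℤ.^ 2 ≡
              ℤ.+ (1 * (1 + 2 * (D ∸ 2)) + 0 * 0 + (⟦ D ≟ 1 ⟧ * leafWeight + (D ∸ 2) * (D ∸ 2)))
      lemma (suc (suc e)) _ = trans (square-difference 1 (1 + e)) (cong ℤ.+_ (arith e))
      lemma 1 (s≤s ())
    typed-square (two {1} (s≤s ()))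
    typed-square (two {suc (suc e)} _) = square-difference 2 e
    onEdge : ∀ {e} → e ∈ edges G → (ℤ.+ d (proj₁ e) ℤ.- ℤ.+ d (proj₂ e)) ℤ.^ 2 ≡ ℤ.+ (h (d (proj₁ e)) + h (d (proj₂ e)))
    onEdge {u , w} e∈ with typed (proj₂ (proj₂ (∈-filter⁻ (λ (u , w) → (u Fin.<? w) ×-dec adj? u w)
      {xs = cartesianProduct (V n) (V n)} e∈)))
    ... | inj₁ g = typed-square g
    ... | inj₂ g = trans (square-difference-comm (ℤ.+ d u) (ℤ.+ d w))
      (trans (typed-square g) (cong ℤ.+_ (+-comm (h (d w)) (h (d u)))))

  module _ (1≤d : ∀ v → 1 ≤ d v) where

    -- The leaf terms are counted by `leafCount`. The two remaining summands, x ∸ 2 and x (x ∸ 2)²,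
    -- vanish at 1 and 2, so the profile evaluates their sums.
    σ-determined : ∀ {k j} → DegreeProfile G Δ k j → σ G ≡ ℤ.+ σ-value Δ k j
    σ-determined {k} {j} profile = trans σ-potential (cong ℤ.+_ (begin
      ∑[ v ∈ V n ] d v * h (d v)
        ≡⟨ ∑-cong (V n) (λ v → pointwise (d v)) ⟩
      ∑[ v ∈ V n ] (⟦ d v ≟ 1 ⟧ * leafWeight + d v * ((d v ∸ 2) * (d v ∸ 2)))
        ≡⟨ ∑-+ (V n) (λ v → ⟦ d v ≟ 1 ⟧ * leafWeight) (λ v → d v * ((d v ∸ 2) * (d v ∸ 2))) ⟩
      (∑[ v ∈ V n ] ⟦ d v ≟ 1 ⟧ * leafWeight) + (∑[ v ∈ V n ] d v * ((d v ∸ 2) * (d v ∸ 2)))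
        ≡⟨ cong₂ _+_
             (trans (∑-*ʳ (V n) leafWeight (λ v → ⟦ d v ≟ 1 ⟧))
                    (cong (_* leafWeight) (trans (leafCount tree 1≤d) (cong (2 +_) (profile (_∸ 2) refl refl)))))
             (profile (λ x → x * ((x ∸ 2) * (x ∸ 2))) refl refl) ⟩
      σ-value Δ k j ∎))
      where
      open ≡-Reasoning
      pointwise : ∀ x → x * h x ≡ ⟦ x ≟ 1 ⟧ * leafWeight + x * ((x ∸ 2) * (x ∸ 2))
      pointwise 0             = refl
      pointwise 1             = arith leafWeight
        where
        arith : ∀ z → 1 * (1 * z + 0 * 0) ≡ 1 * z + 1 * (0 * 0)
        arith = solve-∀
      pointwise (suc (suc x)) = refl

-- Degrees in a member of 𝒯′

quotient-remainder-unique : ∀ {Δ k k′ r r′} → r < Δ → r′ < Δ → k * Δ + r ≡ k′ * Δ + r′ → k ≡ k′ × r ≡ r′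
quotient-remainder-unique {Δ@(suc _)} {k} {k′} {r} {r′} r< r′< e =
  *-cancelʳ-≡ k k′ Δ (+-cancelʳ-≡ r _ _ (trans e (cong (k′ * Δ +_) (sym r≡r′)))) , r≡r′
  where
  remainder : ∀ {q s} → s < Δ → (q * Δ + s) % Δ ≡ s
  remainder {q} {s} s< = trans (cong (_% Δ) (+-comm (q * Δ) s)) (trans ([m+kn]%n≡m%n s q Δ) (m<n⇒m%n≡m s<))
  r≡r′ : r ≡ r′
  r≡r′ = trans (sym (remainder {k} r<)) (trans (cong (_% Δ) e) (remainder {k′} r′<))

module _ {n} (G : SimpleGraph n) where
  open SimpleGraph G
  open ArcSums G

  ∑arcs-≤-≡ : ∀ {f g} → (∀ u w → f u w ≤ g u w) → ∑arcs f ≡ ∑arcs g →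
              ∀ {u w} → Adj u w → f u w ≡ g u w
  ∑arcs-≤-≡ {f} {g} f≤g e {u} {w} a = begin
    f u w                   ≡⟨ *-identityˡ (f u w) ⟨
    1 * f u w               ≡⟨ cong (_* f u w) (⟦⟧-yes (adj? u w) a) ⟨
    ⟦ adj? u w ⟧ * f u w
      ≡⟨ ∑-≤-≡ (V n) (le u) (∑-≤-≡ (V n) (λ u → ∑-mono (V n) (le u)) e (∈-allFin u)) (∈-allFin w) ⟩
    ⟦ adj? u w ⟧ * g u w    ≡⟨ cong (_* g u w) (⟦⟧-yes (adj? u w) a) ⟩
    1 * g u w               ≡⟨ *-identityˡ (g u w) ⟩
    g u w                   ∎
    where
    open ≡-Reasoning
    le : ∀ u w → ⟦ adj? u w ⟧ * f u w ≤ ⟦ adj? u w ⟧ * g u w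
    le u w = *-monoʳ-≤ ⟦ adj? u w ⟧ (f≤g u w)

  -- If all neighbours of w are leaves, the component of w is a star centred at w.
  reaches-star : ∀ {w} → (∀ {x} → Adj w x → degree G x ≤ 1) →
                 ∀ {x u} → x ≡ w ⊎ Adj w x → Star Adj x u → u ≡ w ⊎ Adj w u
  reaches-star leaves x∈ ε = x∈
  reaches-star leaves (inj₁ refl) (a ◅ s) = reaches-star leaves (inj₂ a) s
  reaches-star leaves (inj₂ wx) (a ◅ s) =
    reaches-star leaves (inj₁ (leaf-neighbour-unique _ a (symm wx) (leaves wx))) s

module Members {n Δ} (G : SimpleGraph n) (6≤Δ : 6 ≤ Δ) (member : 𝒯′ n Δ G) where
  open SimpleGraph G
  open ArcSums G
  open 𝒯′ member
  open IsTree isTree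

  private
    d : Fin n → ℕ
    d = degree G

    3≤Δ : 3 ≤ Δ
    3≤Δ = ≤-trans (m≤n+m 3 3) 6≤Δ

    hub : Fin n
    hub = proj₁ (proj₂ maxDegree)

    d-hub : d hub ≡ Δ
    d-hub = proj₂ (proj₂ maxDegree)

  degree≥1 : ∀ v → 1 ≤ d v
  degree≥1 v with connected v hub
  ... | ε     = subst (1 ≤_) (sym d-hub) (≤-trans (s≤s z≤n) 6≤Δ)
  ... | a ◅ _ = Adj⇒1≤degree a

  -- Suppose `w` has degree at most 2 and consider its non-leaf neighbours. With none, the whole
  -- tree is a star around `w`, leaving no room for a vertex of degree Δ. With one, `w` is an
  -- internal leaf, so condition (1) gives it degree Δ. With two or more, the leaf `v` raises its
  -- degree to at least 3.
  leaf-neighbour-big : ∀ {v w} → Adj v w → d v ≡ 1 → 3 ≤ d w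
  leaf-neighbour-big {v} {w} vw dv≡1 with 3 ≤? d w
  ... | yes 3≤ = 3≤
  ... | no 3≰  = ⊥-elim (absurd (#nonleafNeighbours w) refl)
    where
    dw≤2 : d w ≤ 2
    dw≤2 = ≤-pred (≰⇒> 3≰)

    nonleaf? : ∀ x → Dec (Adj w x × 1 < d x)
    nonleaf? x = adj? w x ×-dec (1 <? d x)

    bound : ∀ x → ⟦ nonleaf? x ⟧ + ⟦ x Fin.≟ v ⟧ ≤ ⟦ adj? w x ⟧
    bound x = lemma (nonleaf? x) (x Fin.≟ v)
      where
      lemma : (p : Dec (Adj w x × 1 < d x)) (q : Dec (x ≡ v)) → ⟦ p ⟧ + ⟦ q ⟧ ≤ ⟦ adj? w x ⟧
      lemma (yes (_ , 1<)) (yes refl) = contradiction dv≡1 (>⇒≢ 1<)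
      lemma (yes (wx , _)) (no _)     = ≤-reflexive (sym (⟦⟧-yes (adj? w x) wx))
      lemma (no _)         (yes refl) = ≤-reflexive (sym (⟦⟧-yes (adj? w x) (symm vw)))
      lemma (no _)         (no _)     = z≤n

    few : #nonleafNeighbours w + 1 ≤ d w
    few = begin
      #nonleafNeighbours w + 1
        ≡⟨ cong₂ _+_ (#nonleafNeighbours≡∑ w) (sym (∑V-δ v)) ⟩
      (∑[ x ∈ V n ] ⟦ nonleaf? x ⟧) + (∑[ x ∈ V n ] ⟦ x Fin.≟ v ⟧)
        ≡⟨ ∑-+ (V n) (λ x → ⟦ nonleaf? x ⟧) (λ x → ⟦ x Fin.≟ v ⟧) ⟨
      ∑[ x ∈ V n ] (⟦ nonleaf? x ⟧ + ⟦ x Fin.≟ v ⟧)                    ≤⟨ ∑-mono (V n) bound ⟩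
      ∑[ x ∈ V n ] ⟦ adj? w x ⟧                                       ≡⟨ degree≡∑ w ⟨
      d w                                                             ∎
      where open ≤-Reasoning

    absurd : ∀ c → #nonleafNeighbours w ≡ c → ⊥
    absurd 0 e = [ (λ hub≡w → <⇒≱ 3≤Δ (subst₂ _≤_ (trans (cong d (sym hub≡w)) d-hub) refl dw≤2))
                 , (λ wh → <⇒≱ (≤-trans (n≤1+n 2) 3≤Δ) (subst (_≤ 1) d-hub (leaves wh))) ]
                 (reaches-star G leaves (inj₁ refl) (connected w hub))
      where
      leaves : ∀ {x} → Adj w x → d x ≤ 1
      leaves {x} wx = ≮⇒≥ λ 1< → contradiction
        (subst₂ _≤_ (⟦⟧-yes (nonleaf? x) (wx , 1<)) (trans (sym (#nonleafNeighbours≡∑ w)) e)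
          (∈⇒≤∑ (V n) (λ x → ⟦ nonleaf? x ⟧) (∈-allFin x)))
        λ ()
    absurd 1 e = <⇒≱ (≤-trans 3≤Δ (≤-reflexive (sym (cond₁ w (subst (λ c → c + 1 ≤ d w) e few , e))))) dw≤2
    absurd (suc (suc c)) e =
      <⇒≱ (s≤s (s≤s (m≤n+m 1 c))) (≤-trans (subst (λ c → c + 1 ≤ d w) e few) dw≤2)

  Δ≢Δ-adjacent : ∀ {u w} → Adj u w → d u ≡ Δ → d w ≢ Δ
  Δ≢Δ-adjacent {u} {w} a du dw = contradiction
    (trans (∑arcs-≤-≡ G (λ u w → z≤n {bigBig u w}) (trans ∑arcs-0 (trans (cong (2 *_) (sym (proj₂ cond₂))) (2*#edge-same Δ))) a)
           (cong₂ _*_ (⟦⟧-yes (d u ≟ Δ) du) (⟦⟧-yes (d w ≟ Δ) dw)))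
    λ ()
    where
    bigBig : Fin n → Fin n → ℕ
    bigBig u w = ⟦ d u ≟ Δ ⟧ * ⟦ d w ≟ Δ ⟧
    ∑arcs-0 : ∑arcs (λ _ _ → 0) ≡ 0
    ∑arcs-0 = ∑-0 (V n) λ u → ∑-0 (V n) λ w → *-zeroʳ ⟦ adj? u w ⟧

  Middle : ℕ → Set
  Middle x = 3 ≤ x × x < Δ

  -- r is m₂₂ if there is no vertex of degree 3, …, Δ - 1, and the degree of that vertex otherwise.
  data Defect : ℕ → Set where
    none : (∀ v → ¬ Middle (d v)) → #edge G 2 2 ≢ 0 → Defect (#edge G 2 2)
    one  : ∀ {a} → Middle a → #deg G a ≡ 1 → (∀ v → Middle (d v) → d v ≡ a) →
           (∀ {u w} → Adj u w → d u ≡ a → d w ≡ 2) → #edge G 2 2 ≡ 0 → Defect a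

  private
    Mid≡a⇒ : ∀ {a} → Middle a → ∀ v → ⟦ d v ≟ a ⟧ ≤ ⟦ mid? Δ (d v) ⟧
    Mid≡a⇒ mid v = ⟦⟧-mono (d v ≟ _) (mid? Δ (d v)) (λ { refl → mid })

  -- If m₂₂ = 0, condition (4) supplies `a`; then Σ = nₐ leaves no other intermediate degree, and by
  -- (5) the number of edges from degree `a` to degree 2 exhausts the arcs leaving the vertex of
  -- degree `a`. If m₂₂ ≠ 0, an intermediate vertex would by (3) be the only one, and (4) read
  -- backwards would give m₂₂ = 0.
  defect : ∃ Defect
  defect with #edge G 2 2 ≟ 0
  ... | yes m₂₂≡0 with Equivalence.to cond₄ m₂₂≡0
  ...   | a , exc@(3≤a , a≤Δ-1 , Σ≡ , nₐ≡1) = a , one mid nₐ≡1 only neighbours m₂₂≡0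
    where
    mid : Middle a
    mid = 3≤a , subst (suc a ≤_) (m+[n∸m]≡n (≤-trans (s≤s z≤n) 6≤Δ)) (s≤s a≤Δ-1)
    only : ∀ v → Middle (d v) → d v ≡ a
    only v m = ⟦⟧≡1⇒ (d v ≟ a) (trans
      (∑-≤-≡ (V n) (Mid≡a⇒ mid) (trans (sym (#deg≡∑ a)) (trans (sym Σ≡) (Σ#deg≡∑ 3≤Δ))) (∈-allFin v))
      (⟦⟧-yes (mid? Δ (d v)) m))
    isₐ : Fin n → ℕ
    isₐ u = ⟦ d u ≟ a ⟧
    sums : ∑arcs (λ u w → isₐ u * ⟦ d w ≟ 2 ⟧) ≡ ∑arcs (λ u _ → isₐ u)
    sums = begin
      ∑arcs (λ u w → isₐ u * ⟦ d w ≟ 2 ⟧)  ≡⟨ #edge-distinct (λ { refl → contradiction 3≤a λ { (s≤s (s≤s ())) } }) ⟨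
      #edge G a 2                         ≡⟨ cond₅ m₂₂≡0 a exc ⟩
      a                                   ≡⟨ *-identityʳ a ⟨
      a * 1                               ≡⟨ cong (a *_) nₐ≡1 ⟨
      a * #deg G a                        ≡⟨ ∑arcs-ofDegree a ⟨
      ∑arcs (λ u _ → isₐ u)               ∎
      where open ≡-Reasoning
    neighbours : ∀ {u w} → Adj u w → d u ≡ a → d w ≡ 2
    neighbours {u} {w} uw du≡a = ⟦⟧≡1⇒ (d w ≟ 2) (begin
      ⟦ d w ≟ 2 ⟧            ≡⟨ *-identityˡ _ ⟨
      1 * ⟦ d w ≟ 2 ⟧        ≡⟨ cong (_* ⟦ d w ≟ 2 ⟧) (⟦⟧-yes (d u ≟ a) du≡a) ⟨
      isₐ u * ⟦ d w ≟ 2 ⟧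
        ≡⟨ ∑arcs-≤-≡ G (λ u w → ≤-trans (*-monoʳ-≤ (isₐ u) (⟦⟧≤1 (d w ≟ 2))) (≤-reflexive (*-identityʳ (isₐ u)))) sums uw ⟩
      isₐ u                  ≡⟨ ⟦⟧-yes (d u ≟ a) du≡a ⟩
      1                      ∎)
      where open ≡-Reasoning
  defect | no m₂₂≢0 = _ , none noMiddle m₂₂≢0
    where
    noMiddle : ∀ v → ¬ Middle (d v)
    noMiddle v mid = m₂₂≢0 (Equivalence.from cond₄ (d v , proj₁ mid , ∸-monoˡ-≤ 1 (proj₂ mid) , trans Σ≡1 (sym n≡1) , n≡1))
      where
      Σ≥1 : 1 ≤ Σ#deg G Δ
      Σ≥1 = subst₂ _≤_ (⟦⟧-yes (mid? Δ (d v)) mid) (sym (Σ#deg≡∑ 3≤Δ)) (∈⇒≤∑ (V n) (λ v → ⟦ mid? Δ (d v) ⟧) (∈-allFin v))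
      Σ≡1 : Σ#deg G Δ ≡ 1
      Σ≡1 = ≤-antisym cond₃ Σ≥1
      n≡1 : #deg G (d v) ≡ 1
      n≡1 = ≤-antisym
        (subst₂ _≤_ (sym (#deg≡∑ (d v))) (trans (sym (Σ#deg≡∑ 3≤Δ)) Σ≡1) (∑-mono (V n) (Mid≡a⇒ mid)))
        (subst₂ _≤_ (⟦⟧-yes (d v ≟ d v) refl) (sym (#deg≡∑ (d v))) (∈⇒≤∑ (V n) (λ u → ⟦ d u ≟ d v ⟧) (∈-allFin v)))

  data DegreeClass (x : ℕ) : Set where
    isLeaf : x ≡ 1 → DegreeClass x
    isTwo  : x ≡ 2 → DegreeClass x
    isMid  : Middle x → DegreeClass x
    isBig  : x ≡ Δ → DegreeClass x

  classify : ∀ v → DegreeClass (d v)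
  classify v = go (d v) (degree≥1 v) (proj₁ maxDegree v)
    where
    go : ∀ x → 1 ≤ x → x ≤ Δ → DegreeClass x
    go 1 _ _ = isLeaf refl
    go 2 _ _ = isTwo refl
    go x@(suc (suc (suc _))) _ x≤Δ with x ≟ Δ
    ... | yes e = isBig e
    ... | no ne = isMid (s≤s (s≤s (s≤s z≤n)) , ≤∧≢⇒< x≤Δ ne)

  middle-neighbour : ∀ {u w} → Adj u w → Middle (d u) → d w ≡ 2
  middle-neighbour {u} a m with defect
  ... | _ , none no-mid _      = contradiction m (no-mid u)
  ... | _ , one _ _ only nbr _ = nbr a (only u m)

  -- Leaves meet only degrees at least 3, the intermediate vertex meets only degree 2, and vertices
  -- of degree Δ do not meet each other; the pairs left over are the two types.
  edgesTyped : EdgesTyped G Δ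
  edgesTyped {u} {w} a = go (classify u) (classify w)
    where
    ¬3≤2 : ∀ {x} → x ≡ 2 → ¬ 3 ≤ x
    ¬3≤2 refl (s≤s (s≤s ()))
    ¬3≤1 : ∀ {x} → x ≡ 1 → ¬ 3 ≤ x
    ¬3≤1 refl (s≤s ())
    ≡⇒≥3 : ∀ {x} → x ≡ Δ → 3 ≤ x
    ≡⇒≥3 e = subst (3 ≤_) (sym e) 3≤Δ
    go : DegreeClass (d u) → DegreeClass (d w) → EdgeType Δ (d u) (d w) ⊎ EdgeType Δ (d w) (d u)
    go (isLeaf e) (isLeaf f) = contradiction (leaf-neighbour-big a e) (¬3≤1 f)
    go (isLeaf e) (isTwo f)  = contradiction (leaf-neighbour-big a e) (¬3≤2 f)
    go (isLeaf e) (isMid m)  = contradiction (trans (sym e) (middle-neighbour (symm a) m)) λ ()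
    go (isLeaf e) (isBig f)  rewrite e | f = inj₁ leaf
    go (isTwo e)  (isLeaf f) = contradiction (leaf-neighbour-big (symm a) f) (¬3≤2 e)
    go (isTwo e)  (isTwo f)  rewrite e | f = inj₁ (two ≤-refl)
    go (isTwo e)  (isMid m)  rewrite e = inj₁ (two (≤-trans (n≤1+n 2) (proj₁ m)))
    go (isTwo e)  (isBig f)  = subst (λ x → EdgeType Δ x (d w) ⊎ EdgeType Δ (d w) x) (sym e)
                                 (inj₁ (two (≤-trans (n≤1+n 2) (≡⇒≥3 f))))
    go (isMid m)  (isLeaf f) = contradiction (trans (sym f) (middle-neighbour a m)) λ ()
    go (isMid m)  (isTwo f)  rewrite f = inj₂ (two (≤-trans (n≤1+n 2) (proj₁ m)))
    go (isMid m)  (isMid m′) = contradiction (proj₁ m′) (¬3≤2 (middle-neighbour a m))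
    go (isMid m)  (isBig f)  = contradiction (≡⇒≥3 f) (¬3≤2 (middle-neighbour a m))
    go (isBig e)  (isLeaf f) rewrite e | f = inj₂ leaf
    go (isBig e)  (isTwo f)  = subst (λ x → EdgeType Δ (d u) x ⊎ EdgeType Δ x (d u)) (sym f)
                                 (inj₂ (two (≤-trans (n≤1+n 2) (≡⇒≥3 e))))
    go (isBig e)  (isMid m)  = contradiction (≡⇒≥3 e) (¬3≤2 (middle-neighbour (symm a) m))
    go (isBig e)  (isBig f)  = contradiction f (Δ≢Δ-adjacent a e)

  open EdgeEquations G isTree 3≤Δ edgesTyped

  private
    bigPart : (F : ℕ → ℕ) → Fin n → ℕ
    bigPart F v = ⟦ d v ≟ Δ ⟧ * F Δ

    bigPart-big : ∀ F v → d v ≡ Δ → bigPart F v ≡ F (d v)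
    bigPart-big F v e = trans (cong (_* F Δ) (⟦⟧-yes (d v ≟ Δ) e)) (trans (*-identityˡ (F Δ)) (cong F (sym e)))

    bigPart-other : ∀ F v → d v ≢ Δ → bigPart F v ≡ 0
    bigPart-other F v ne = cong (_* F Δ) (⟦⟧-no (d v ≟ Δ) ne)

    ∑bigPart : ∀ F → ∑ (V n) (bigPart F) ≡ #deg G Δ * F Δ
    ∑bigPart F = trans (∑-*ʳ (V n) (F Δ) (λ v → ⟦ d v ≟ Δ ⟧)) (cong (_* F Δ) (sym (#deg≡∑ Δ)))

    1≢Δ : 1 ≢ Δ
    1≢Δ = <⇒≢ (≤-trans (s≤s (s≤s z≤n)) 3≤Δ)

    2≢Δ : 2 ≢ Δ
    2≢Δ = <⇒≢ 3≤Δ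

  profile-defect : ∀ {r} → Defect r → DegreeProfile G Δ (#deg G Δ) r
  profile-defect (none noMiddle m₂₂≢0) F F1 F2 = begin
    ∑[ v ∈ V n ] F (d v)                 ≡⟨ ∑-cong (V n) (λ v → pointwise v (classify v)) ⟩
    ∑ (V n) (bigPart F)                  ≡⟨ ∑bigPart F ⟩
    #deg G Δ * F Δ                       ≡⟨ +-identityʳ _ ⟨
    -- Here the second parameter of the profile is m₂₂, which is 1 or 2; `F` vanishes there, so the
    -- term stands for no vertex.
    #deg G Δ * F Δ + 0                   ≡⟨ cong (#deg G Δ * F Δ +_) (F-small (#edge G 2 2) m₂₂≢0 (proj₁ cond₂)) ⟨
    #deg G Δ * F Δ + F (#edge G 2 2)     ∎
    where
    open ≡-Reasoning
    F-small : ∀ x → x ≢ 0 → x ≤ 2 → F x ≡ 0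
    F-small 0 ne _ = contradiction refl ne
    F-small 1 _ _ = F1
    F-small 2 _ _ = F2
    F-small (suc (suc (suc _))) _ (s≤s (s≤s ()))
    pointwise : ∀ v → DegreeClass (d v) → F (d v) ≡ bigPart F v
    pointwise v (isLeaf e) = trans (trans (cong F e) F1) (sym (bigPart-other F v (1≢Δ ∘ trans (sym e))))
    pointwise v (isTwo e)  = trans (trans (cong F e) F2) (sym (bigPart-other F v (2≢Δ ∘ trans (sym e))))
    pointwise v (isMid m)  = contradiction m (noMiddle v)
    pointwise v (isBig e)  = sym (bigPart-big F v e)
  profile-defect (one {a} mid nₐ≡1 only _ _) F F1 F2 = begin
    ∑[ v ∈ V n ] F (d v)                                        ≡⟨ ∑-cong (V n) (λ v → pointwise v (classify v)) ⟩
    ∑[ v ∈ V n ] (bigPart F v + ⟦ d v ≟ a ⟧ * F a)               ≡⟨ ∑-+ (V n) (bigPart F) (λ v → ⟦ d v ≟ a ⟧ * F a) ⟩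
    ∑ (V n) (bigPart F) + (∑[ v ∈ V n ] ⟦ d v ≟ a ⟧ * F a)
      ≡⟨ cong₂ _+_ (∑bigPart F) (∑-*ʳ (V n) (F a) (λ v → ⟦ d v ≟ a ⟧)) ⟩
    #deg G Δ * F Δ + (∑[ v ∈ V n ] ⟦ d v ≟ a ⟧) * F a
      ≡⟨ cong (λ z → #deg G Δ * F Δ + z * F a) (trans (sym (#deg≡∑ a)) nₐ≡1) ⟩
    #deg G Δ * F Δ + 1 * F a                                    ≡⟨ cong (#deg G Δ * F Δ +_) (*-identityˡ (F a)) ⟩
    #deg G Δ * F Δ + F a                                        ∎
    where
    open ≡-Reasoning
    aPart-other : ∀ v → d v ≢ a → ⟦ d v ≟ a ⟧ * F a ≡ 0
    aPart-other v ne = cong (_* F a) (⟦⟧-no (d v ≟ a) ne)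
    pointwise : ∀ v → DegreeClass (d v) → F (d v) ≡ bigPart F v + ⟦ d v ≟ a ⟧ * F a
    pointwise v (isLeaf e) = trans (trans (cong F e) F1) (sym (cong₂ _+_
      (bigPart-other F v (1≢Δ ∘ trans (sym e)))
      (aPart-other v λ f → contradiction (subst (3 ≤_) (trans (sym f) e) (proj₁ mid)) λ { (s≤s ()) })))
    pointwise v (isTwo e)  = trans (trans (cong F e) F2) (sym (cong₂ _+_
      (bigPart-other F v (2≢Δ ∘ trans (sym e)))
      (aPart-other v λ f → contradiction (subst (3 ≤_) (trans (sym f) e) (proj₁ mid)) λ { (s≤s (s≤s ())) })))
    pointwise v (isMid m)  = trans (trans (cong F (only v m)) (sym (*-identityˡ (F a)))) (sym (cong₂ _+_
      (bigPart-other F v (<⇒≢ (proj₂ m)))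
      (cong (_* F a) (⟦⟧-yes (d v ≟ a) (only v m)))))
    pointwise v (isBig e)  = trans (sym (+-identityʳ (F (d v)))) (sym (cong₂ _+_ (bigPart-big F v e)
      (aPart-other v λ f → <⇒≢ (proj₂ mid) (trans (sym f) e))))

  profile-of : ∀ {k j} → n ≡ k * Δ + 1 + j → j < Δ → DegreeProfile G Δ k j
  profile-of {k} {j} n≡ j<Δ with defect
  ... | r , def = subst₂ (DegreeProfile G Δ) (proj₁ unique) (proj₂ unique) (profile-defect def)
    where
    big : ℕ → ℕ
    big x = x * ⟦ 3 ≤? x ⟧
    r<Δ : ∀ {r} → Defect r → r < Δ
    r<Δ (none _ _) = ≤-trans (s≤s (proj₁ cond₂)) 3≤Δ
    r<Δ (one mid _ _ _ _) = proj₂ mid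
    -- The two cases swap roles: in `none` the first summand is 0 and m₂₂ is `r`, in `one` the first
    -- is `r` and m₂₂ is 0.
    defect-size : ∀ {r} → Defect r → big r + #edge G 2 2 ≡ r
    defect-size (none _ ne) = small (#edge G 2 2) (proj₁ cond₂)
      where
      small : ∀ x → x ≤ 2 → big x + x ≡ x
      small 0 _ = refl
      small 1 _ = refl
      small 2 _ = refl
      small (suc (suc (suc _))) (s≤s (s≤s ()))
    defect-size (one {a} (3≤a , _) _ _ _ m₂₂≡0) =
      trans (cong₂ _+_ (trans (cong (a *_) (⟦⟧-yes (3 ≤? a) 3≤a)) (*-identityʳ a)) m₂₂≡0) (+-identityʳ a)
    unique : #deg G Δ ≡ k × r ≡ j
    unique = quotient-remainder-unique (r<Δ def) j<Δ (+-cancelʳ-≡ 1 _ _ (begin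
      #deg G Δ * Δ + r + 1                          ≡⟨ cong (λ z → #deg G Δ * Δ + z + 1) (defect-size def) ⟨
      #deg G Δ * Δ + (big r + #edge G 2 2) + 1      ≡⟨ cong (_+ 1) (+-assoc (#deg G Δ * Δ) (big r) _) ⟨
      #deg G Δ * Δ + big r + #edge G 2 2 + 1
        ≡⟨ cong (λ z → #deg G Δ * z + big r + #edge G 2 2 + 1) (trans (cong (Δ *_) (⟦⟧-yes (3 ≤? Δ) 3≤Δ)) (*-identityʳ Δ)) ⟨
      #deg G Δ * big Δ + big r + #edge G 2 2 + 1
        ≡⟨ cong (λ z → z + #edge G 2 2 + 1) (profile-defect def big refl refl) ⟨
      (∑[ v ∈ V n ] big (d v)) + #edge G 2 2 + 1    ≡⟨ big-cover ⟩
      n                                             ≡⟨ n≡ ⟩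
      k * Δ + 1 + j                                 ≡⟨ arith (k * Δ) j ⟩
      k * Δ + j + 1                                 ∎))
      where
      open ≡-Reasoning
      arith : ∀ x y → x + 1 + y ≡ x + y + 1
      arith = solve-∀

  σ-member : ∀ {k j} → n ≡ k * Δ + 1 + j → j < Δ → σ G ≡ ℤ.+ σ-value Δ k j
  σ-member {k} {j} n≡ j<Δ = σ-determined degree≥1 {k} {j} (profile-of {k} {j} n≡ j<Δ)

-- Existence

-- The converse of the analysis of members: edge types, degrees and maximum degree imply all five
-- conditions, so the construction need not keep track of any m_{ij}.
module Criterion {n Δ k j} (G : SimpleGraph n) (6≤Δ : 6 ≤ Δ) (1≤j : 1 ≤ j) (j<Δ : j < Δ)
  (n≡ : n ≡ k * Δ + 1 + j) (tree : IsTree G) (typed : EdgesTyped G Δ) (profile : DegreeProfile G Δ k j) where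
  open SimpleGraph G
  open ArcSums G

  private
    d : Fin n → ℕ
    d = degree G

    3≤Δ : 3 ≤ Δ
    3≤Δ = ≤-trans (m≤n+m 3 3) 6≤Δ

    2≤Δ : 2 ≤ Δ
    2≤Δ = ≤-trans (n≤1+n 2) 3≤Δ

  open EdgeEquations G tree 3≤Δ typed

  -- Of the n - 1 = k Δ + j edges, k Δ have an end of degree Δ. The other j are those at the vertex
  -- of degree `j` if `j` is at least 3, and those joining two vertices of degree 2.
  m₂₂-value : j * ⟦ 3 ≤? j ⟧ + #edge G 2 2 ≡ j
  m₂₂-value = +-cancelˡ-≡ (k * Δ + 1) _ _ (begin
    k * Δ + 1 + (big j + #edge G 2 2)           ≡⟨ arith (k * Δ) (big j) (#edge G 2 2) ⟩
    k * Δ + big j + #edge G 2 2 + 1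
      ≡⟨ cong (λ z → k * z + big j + #edge G 2 2 + 1) (trans (cong (Δ *_) (⟦⟧-yes (3 ≤? Δ) 3≤Δ)) (*-identityʳ Δ)) ⟨
    k * big Δ + big j + #edge G 2 2 + 1         ≡⟨ cong (λ z → z + #edge G 2 2 + 1) (profile big refl refl) ⟨
    (∑[ v ∈ V n ] big (d v)) + #edge G 2 2 + 1  ≡⟨ big-cover ⟩
    n                                           ≡⟨ n≡ ⟩
    k * Δ + 1 + j                               ∎)
    where
    open ≡-Reasoning
    big : ℕ → ℕ
    big x = x * ⟦ 3 ≤? x ⟧
    arith : ∀ x y z → x + 1 + (y + z) ≡ x + y + z + 1
    arith = solve-∀

  m₂₂≡0 : 3 ≤ j → #edge G 2 2 ≡ 0
  m₂₂≡0 3≤j = +-cancelˡ-≡ j _ _ (begin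
    j + #edge G 2 2
      ≡⟨ cong (_+ #edge G 2 2) (trans (cong (j *_) (⟦⟧-yes (3 ≤? j) 3≤j)) (*-identityʳ j)) ⟨
    j * ⟦ 3 ≤? j ⟧ + #edge G 2 2    ≡⟨ m₂₂-value ⟩
    j                               ≡⟨ +-identityʳ j ⟨
    j + 0                           ∎)
    where open ≡-Reasoning

  m₂₂≡j : ¬ 3 ≤ j → #edge G 2 2 ≡ j
  m₂₂≡j 3≰j = trans (cong (_+ #edge G 2 2) (sym (trans (cong (j *_) (⟦⟧-no (3 ≤? j) 3≰j)) (*-zeroʳ j)))) m₂₂-value

  Σ#deg-value : Σ#deg G Δ ≡ ⟦ mid? Δ j ⟧
  Σ#deg-value = begin
    Σ#deg G Δ                             ≡⟨ Σ#deg≡∑ 3≤Δ ⟩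
    ∑[ v ∈ V n ] ⟦ mid? Δ (d v) ⟧         ≡⟨ profile (λ x → ⟦ mid? Δ x ⟧) refl refl ⟩
    k * ⟦ mid? Δ Δ ⟧ + ⟦ mid? Δ j ⟧
      ≡⟨ cong (λ z → k * z + ⟦ mid? Δ j ⟧) (⟦⟧-no (mid? Δ Δ) (<-irrefl refl ∘ proj₂)) ⟩
    k * 0 + ⟦ mid? Δ j ⟧                  ≡⟨ cong (_+ ⟦ mid? Δ j ⟧) (*-zeroʳ k) ⟩
    ⟦ mid? Δ j ⟧                          ∎
    where open ≡-Reasoning

  #deg-value : ∀ {a} → 3 ≤ a → a < Δ → #deg G a ≡ ⟦ j ≟ a ⟧
  #deg-value {a} 3≤a a<Δ = begin
    #deg G a                      ≡⟨ #deg≡∑ a ⟩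
    ∑[ v ∈ V n ] ⟦ d v ≟ a ⟧
      ≡⟨ profile (λ x → ⟦ x ≟ a ⟧) (⟦⟧-no (1 ≟ a) (<⇒≢ (≤-trans (n≤1+n 2) 3≤a))) (⟦⟧-no (2 ≟ a) (<⇒≢ 3≤a)) ⟩
    k * ⟦ Δ ≟ a ⟧ + ⟦ j ≟ a ⟧     ≡⟨ cong (λ z → k * z + ⟦ j ≟ a ⟧) (⟦⟧-no (Δ ≟ a) (>⇒≢ a<Δ)) ⟩
    k * 0 + ⟦ j ≟ a ⟧             ≡⟨ cong (_+ ⟦ j ≟ a ⟧) (*-zeroʳ k) ⟩
    ⟦ j ≟ a ⟧                     ∎
    where open ≡-Reasoning

  exceptional-unique : ∀ {a} → IsExceptionalDegree G Δ a → j ≡ a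
  exceptional-unique {a} (3≤a , a≤Δ-1 , _ , nₐ≡1) =
    ⟦⟧≡1⇒ (j ≟ a) (trans (sym (#deg-value 3≤a a<Δ)) nₐ≡1)
    where
    a<Δ : a < Δ
    a<Δ = subst (suc a ≤_) (m+[n∸m]≡n (≤-trans (n≤1+n 1) 2≤Δ)) (s≤s a≤Δ-1)

  exceptional-j : 3 ≤ j → IsExceptionalDegree G Δ j
  exceptional-j 3≤j = 3≤j , ∸-monoˡ-≤ 1 j<Δ , trans Σ≡1 (sym nⱼ≡1) , nⱼ≡1
    where
    nⱼ≡1 : #deg G j ≡ 1
    nⱼ≡1 = trans (#deg-value 3≤j j<Δ) (⟦⟧-yes (j ≟ j) refl)
    Σ≡1 : Σ#deg G Δ ≡ 1
    Σ≡1 = trans Σ#deg-value (⟦⟧-yes (mid? Δ j) (3≤j , j<Δ))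

  no-big-big : ∀ {x y} → EdgeType Δ x y → x ≡ Δ → ⊥
  no-big-big leaf    e = <⇒≢ 2≤Δ e
  no-big-big (two _) e = <⇒≢ 3≤Δ e

  middle-meets-two : ∀ {x y} → EdgeType Δ x y ⊎ EdgeType Δ y x → 3 ≤ x → x < Δ → y ≡ 2
  middle-meets-two (inj₁ leaf) (s≤s ()) _
  middle-meets-two (inj₁ (two _)) (s≤s (s≤s ())) _
  middle-meets-two (inj₂ leaf) _ x<Δ = contradiction refl (<⇒≢ x<Δ)
  middle-meets-two (inj₂ (two _)) _ _ = refl

  nonleaf-neighbour : ∀ {x y} → EdgeType Δ x y ⊎ EdgeType Δ y x → 2 ≤ x → x ≢ Δ → 1 < y
  nonleaf-neighbour (inj₁ leaf) (s≤s ()) _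
  nonleaf-neighbour (inj₁ (two 2≤y)) _ _ = 2≤y
  nonleaf-neighbour (inj₂ leaf) _ x≢Δ = contradiction refl x≢Δ
  nonleaf-neighbour (inj₂ (two _)) _ _ = ≤-refl

  -- A non-leaf of degree other than Δ has no leaf among its neighbours, so having a single non-leaf
  -- neighbour would make its degree 1.
  internal-leaf-big : ∀ v → IsInternalLeaf G v → d v ≡ Δ
  internal-leaf-big v (2≤dv , one) with d v ≟ Δ
  ... | yes e = e
  ... | no ne = contradiction 2≤dv (<⇒≱ (s≤s (≤-reflexive (begin
    d v                                                  ≡⟨ degree≡∑ v ⟩
    ∑[ w ∈ V n ] ⟦ adj? v w ⟧
      ≡⟨ ∑-cong (V n) (λ w → ⟦⟧-cong (adj? v w) (adj? v w ×-dec (1 <? d w))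
        (λ a → a , nonleaf-neighbour (typed a) 2≤dv ne) proj₁) ⟩
    ∑[ w ∈ V n ] ⟦ adj? v w ×-dec (1 <? d w) ⟧           ≡⟨ #nonleafNeighbours≡∑ v ⟨
    #nonleafNeighbours v                                 ≡⟨ one ⟩
    1                                                    ∎))))
    where open ≡-Reasoning

  m_ΔΔ≡0 : #edge G Δ Δ ≡ 0
  m_ΔΔ≡0 = *-cancelˡ-≡ _ _ 2 (begin
    2 * #edge G Δ Δ                                   ≡⟨ 2*#edge-same Δ ⟩
    ∑arcs (λ u w → ⟦ d u ≟ Δ ⟧ * ⟦ d w ≟ Δ ⟧)
      ≡⟨ ∑arcs-cong (λ {u} {w} a → trans (sym (⟦⟧-× (d u ≟ Δ) (d w ≟ Δ))) (⟦⟧-no ((d u ≟ Δ) ×-dec (d w ≟ Δ))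
        λ (e , f) → [ (λ t → no-big-big t e) , (λ t → no-big-big t f) ] (typed a))) ⟩
    ∑arcs (λ _ _ → 0)                                 ≡⟨ (∑-0 (V n) λ u → ∑-0 (V n) λ w → *-zeroʳ ⟦ adj? u w ⟧) ⟩
    0                                                 ∎)
    where open ≡-Reasoning

  -- All arcs leaving the one vertex of degree `j` end in degree 2, and there are `j` of them.
  m₂ⱼ : 3 ≤ j → #edge G j 2 ≡ j
  m₂ⱼ 3≤j = begin
    #edge G j 2                                  ≡⟨ #edge-distinct (>⇒≢ 3≤j) ⟩
    ∑arcs (λ u w → ⟦ d u ≟ j ⟧ * ⟦ d w ≟ 2 ⟧)    ≡⟨ ∑arcs-cong (λ {u} {w} a → trans (⟦⟧*-cong (d u ≟ j)
        (λ e → ⟦⟧-yes (d w ≟ 2) (middle-meets-two (typed a)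
          (subst (3 ≤_) (sym e) 3≤j) (subst (_< Δ) (sym e) j<Δ))))
        (*-identityʳ ⟦ d u ≟ j ⟧)) ⟩
    ∑arcs (λ u _ → ⟦ d u ≟ j ⟧)                  ≡⟨ ∑arcs-ofDegree j ⟩
    j * #deg G j                                 ≡⟨ cong (j *_) (proj₂ (proj₂ (proj₂ (exceptional-j 3≤j)))) ⟩
    j * 1                                        ≡⟨ *-identityʳ j ⟩
    j                                            ∎
    where open ≡-Reasoning

  m₂₂≡0⇒3≤j : #edge G 2 2 ≡ 0 → 3 ≤ j
  m₂₂≡0⇒3≤j e with 3 ≤? j
  ... | yes 3≤j = 3≤j
  ... | no 3≰j  = contradiction (trans (sym (m₂₂≡j 3≰j)) e) (>⇒≢ 1≤j)

  member : IsMaxDegree G Δ → 𝒯′ n Δ G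
  member maxDegree = record
    { isTree    = tree
    ; maxDegree = maxDegree
    ; cond₁     = internal-leaf-big
    ; cond₂     = m₂₂≤2 , m_ΔΔ≡0
    ; cond₃     = subst (_≤ 1) (sym Σ#deg-value) (⟦⟧≤1 (mid? Δ j))
    ; cond₄     = mk⇔ (λ e → j , exceptional-j (m₂₂≡0⇒3≤j e))
                      (λ (a , exc) → m₂₂≡0 (subst (3 ≤_) (sym (exceptional-unique exc)) (proj₁ exc)))
    ; cond₅     = λ e a exc → subst (λ a → #edge G a 2 ≡ a) (exceptional-unique exc) (m₂ⱼ (m₂₂≡0⇒3≤j e))
    }
    where
    m₂₂≤2 : #edge G 2 2 ≤ 2
    m₂₂≤2 with 3 ≤? j
    ... | yes 3≤j = ≤-trans (≤-reflexive (m₂₂≡0 3≤j)) z≤n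
    ... | no 3≰j  = ≤-trans (≤-reflexive (m₂₂≡j 3≰j)) (≤-pred (≰⇒> 3≰j))

-- Attaching a leaf to a tree

module Attach {n} (G : SimpleGraph n) (v : Fin n) where
  open SimpleGraph G

  AttachAdj : Fin (suc n) → Fin (suc n) → Set
  AttachAdj zero    zero    = ⊥
  AttachAdj zero    (suc w) = w ≡ v
  AttachAdj (suc u) zero    = u ≡ v
  AttachAdj (suc u) (suc w) = Adj u w

  -- The new leaf is vertex 0; the old vertices are shifted by one.
  attach : SimpleGraph (suc n)
  attach = record
    { Adj    = AttachAdj
    ; adj?   = adj?′
    ; symm   = λ {u} {w} → symm′ u w
    ; irrefl = λ { {u} refl → irrefl′ u }
    }
    where
    adj?′ : ∀ u w → Dec (AttachAdj u w)
    adj?′ zero    zero    = no λ ()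
    adj?′ zero    (suc w) = w Fin.≟ v
    adj?′ (suc u) zero    = u Fin.≟ v
    adj?′ (suc u) (suc w) = adj? u w
    symm′ : ∀ u w → AttachAdj u w → AttachAdj w u
    symm′ zero    (suc w) e = e
    symm′ (suc u) zero    e = e
    symm′ (suc u) (suc w) a = symm a
    irrefl′ : ∀ u → ¬ AttachAdj u u
    irrefl′ (suc u) a = irrefl refl a

  degree-new : degree attach zero ≡ 1
  degree-new = trans (ArcSums.degree≡∑ attach zero)
    (trans (∑V-suc (λ w → ⟦ SimpleGraph.adj? attach zero w ⟧)) (∑V-δ v))

  degree-old : ∀ u → degree attach (suc u) ≡ ⟦ u Fin.≟ v ⟧ + degree G u
  degree-old u = trans (ArcSums.degree≡∑ attach (suc u))
    (trans (∑V-suc (λ w → ⟦ SimpleGraph.adj? attach (suc u) w ⟧))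
           (cong (⟦ u Fin.≟ v ⟧ +_) (sym (ArcSums.degree≡∑ G u))))

  unshift : ∀ {xs : List (Fin (suc n))} → zero ∉ xs → ∃[ ys ] xs ≡ map suc ys
  unshift {[]}         _  = [] , refl
  unshift {zero ∷ _}   z∉ = contradiction (here refl) z∉
  unshift {suc x ∷ _}  z∉ with unshift (z∉ ∘ there)
  ... | ys , refl = x ∷ ys , refl

  neighbour-of-new : ∀ {u} → AttachAdj zero u → u ≡ suc v
  neighbour-of-new {suc u} e = cong suc e

  neighbour-of-new′ : ∀ {u} → AttachAdj u zero → u ≡ suc v
  neighbour-of-new′ {suc u} e = cong suc e

  before-new : ∀ x vs → Linked AttachAdj (x ∷ (vs ∷ʳ zero)) → suc v ∈ x ∷ vs
  before-new x []       (a ∷ _) = here (sym (neighbour-of-new′ a))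
  before-new x (y ∷ vs) (_ ∷ l) = there (before-new y vs l)

  -- A path of distinct vertices through the leaf must end there, so the walk's endpoint is the attachment vertex.
  through-new : ∀ p vs e → Unique (p ∷ vs) → Linked AttachAdj (p ∷ (vs ∷ʳ e)) → zero ∈ vs → e ≡ suc v × suc v ∈ p ∷ vs
  through-new p (_ ∷ []) e _ (a ∷ b ∷ _) (here refl) =
    neighbour-of-new b , here (sym (neighbour-of-new′ a))
  through-new p (_ ∷ y ∷ vs) e ((_ ∷ p≢y ∷ _) ∷ _) (a ∷ b ∷ _) (here refl) =
    contradiction (trans (neighbour-of-new′ a) (sym (neighbour-of-new b))) p≢y
  through-new p (x ∷ vs) e (_ ∷ u) (_ ∷ l) (there z∈) with through-new x vs e u l z∈
  ... | e≡ , v∈ = e≡ , there v∈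

  -- A vertex of a cycle has two distinct neighbours on it, whereas the new leaf has only `suc v`.
  -- The cases are: the new leaf is the base of the cycle, comes right after the base, comes later,
  -- or is absent; in the last case the cycle descends to `G`.
  attach-acyclic : (∀ u vs → ¬ IsCycle G u vs) → ∀ u vs → ¬ IsCycle attach u vs
  attach-acyclic acyclic zero (x ∷ y ∷ vs) c with IsCycle.closed c | IsCycle.distinct c
  ... | a ∷ _ ∷ l | _ ∷ (x∉ ∷ _) = All¬⇒¬Any x∉ (subst (_∈ y ∷ vs) (sym (neighbour-of-new a)) (before-new y vs l))
  attach-acyclic acyclic zero (x ∷ []) c with IsCycle.long c
  ... | s≤s ()
  attach-acyclic acyclic (suc u) vs c with zero ∈? vs
    where open import Data.List.Membership.DecPropositional (Fin._≟_ {suc n}) using (_∈?_)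
  attach-acyclic acyclic (suc u) (_ ∷ []) c | yes (here refl) with IsCycle.long c
  ... | s≤s ()
  attach-acyclic acyclic (suc u) (_ ∷ y ∷ vs) c | yes (here refl) with IsCycle.closed c | IsCycle.distinct c
  ... | a ∷ b ∷ _ | (_ ∷ u≢y ∷ _) ∷ _ = u≢y (trans (neighbour-of-new′ a) (sym (neighbour-of-new b)))
  attach-acyclic acyclic (suc u) (x ∷ vs) c | yes (there z∈) with IsCycle.closed c | IsCycle.distinct c
  ... | _ ∷ l | u∉ ∷ d with through-new x vs (suc u) d l z∈
  ...   | e , v∈ = All¬⇒¬Any u∉ (subst (_∈ x ∷ vs) (sym e) v∈)
  attach-acyclic acyclic (suc u) vs c | no z∉ with unshift z∉
  ... | ws , refl = acyclic u ws record
    { long     = subst (2 ≤_) (length-map suc ws) long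
    ; distinct = Unique.map⁻ {xs = u ∷ ws} distinct
    ; closed   = Linked.map⁻ {xs = u ∷ (ws ∷ʳ u)}
                   (subst (λ xs → Linked AttachAdj (suc u ∷ xs)) (sym (map-++ suc ws (u ∷ []))) closed)
    }
    where open IsCycle c

  attach-tree : IsTree G → IsTree attach
  attach-tree tree = record
    { nonempty  = z<s
    ; connected = connected′
    ; acyclic   = attach-acyclic acyclic
    }
    where
    open IsTree tree
    lift : ∀ {u w} → Star Adj u w → Star AttachAdj (suc u) (suc w)
    lift = Star.gmap suc id
    connected′ : ∀ u w → Star AttachAdj u w
    connected′ zero    zero    = ε
    connected′ zero    (suc w) = refl ◅ lift (connected v w)
    connected′ (suc u) zero    = lift (connected u v) ◅◅ (refl ◅ ε)
    connected′ (suc u) (suc w) = lift (connected u w)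

-- Growing trees in stages

-- A pending vertex is a leaf that still has to become a vertex of degree 2.
data Kind : Set where
  pending leaf two centre big : Kind

-- `pending-centre` is an edge of the initial star and `pending-pending` the edge of K₂; the latter
-- passes through `pending-two` to `two-two` as its ends are expanded. The links without a pending
-- end are instances of `EdgeType`.
data Link : Kind → Kind → Set where
  leaf-big        : Link leaf big
  two-big         : Link two big
  two-two         : Link two two
  two-centre      : Link two centre
  pending-centre  : Link pending centre
  pending-two     : Link pending two
  pending-pending : Link pending pending

Linkable : Kind → Kind → Set
Linkable x y = Link x y ⊎ Link y x

data Expandable : Kind → Set where
  pending : Expandable pending
  leaf    : Expandable leaf

expand-link : ∀ {x y} → Expandable x → Linkable x y → Linkable two y
expand-link pending (inj₁ pending-centre)  = inj₁ two-centre
expand-link pending (inj₁ pending-two)     = inj₁ two-two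
expand-link pending (inj₁ pending-pending) = inj₂ pending-two
expand-link pending (inj₂ pending-pending) = inj₂ pending-two
expand-link leaf    (inj₁ leaf-big)        = inj₁ two-big

singleton : SimpleGraph 1
singleton = record { Adj = λ _ _ → ⊥ ; adj? = λ _ _ → no λ () ; symm = λ () ; irrefl = λ _ () }

singleton-tree : IsTree singleton
singleton-tree = record
  { nonempty  = z<s
  ; connected = λ { zero zero → ε }
  ; acyclic   = λ { u (x ∷ vs) c → acyclic u x vs (IsCycle.closed c) ; u [] c → contradiction (IsCycle.long c) λ () }
  }
  where
  acyclic : ∀ u x vs → ¬ Linked (λ _ _ → ⊥) (u ∷ ((x ∷ vs) ∷ʳ u))
  acyclic u x vs (() ∷ _)

module Construction (Δ c : ℕ) (3≤Δ : 3 ≤ Δ) (2≤c : 2 ≤ c) (c<Δ : c < Δ) where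

  target : Kind → ℕ
  target pending = 1
  target leaf    = 1
  target two     = 2
  target centre  = c
  target big     = Δ

  -- Stated with test functions like `DegreeProfile`, which it yields for `f = F ∘ target` once `p`
  -- is 0. Leaves and vertices of degree 2 stay uncounted, matching F 1 = F 2 = 0.
  Census : (Fin m → Kind) → (p q k : ℕ) → Set
  Census {m} kind p q k = ∀ (f : Kind → ℕ) → f leaf ≡ 0 → f two ≡ 0 →
    ∑[ v ∈ V m ] f (kind v) ≡ p * f pending + (q * f centre + k * f big)

  -- Only the hub, of kind x, may be short of its target degree: it still lacks r leaves.
  record Stage (m : ℕ) (x : Kind) (r p q k : ℕ) : Set₁ where
    field
      graph    : SimpleGraph m
      tree     : IsTree graph
      kind     : Fin m → Kind
      hub      : Fin m
      hub-kind : kind hub ≡ x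
      links    : ∀ {u w} → SimpleGraph.Adj graph u w → Linkable (kind u) (kind w)
      degrees  : ∀ u → degree graph u + ⟦ u Fin.≟ hub ⟧ * r ≡ target (kind u)
      census   : Census kind p q k

  newKind : Kind → (Fin m → Kind) → Fin (suc m) → Kind
  newKind b kind zero    = b
  newKind b kind (suc u) = kind u

  -- `recount` lets one construction serve both kinds of new leaf: `p′` is `p` for `leaf`, whose
  -- weight is 0, and `suc p` for `pending`.
  addLeaf : ∀ {x r p q k p′} (b : Kind) → target b ≡ 1 → Linkable b x →
            (∀ f → f leaf ≡ 0 → p′ * f pending ≡ f b + p * f pending) →
            Stage m x (suc r) p q k → Stage (suc m) x r p′ q k
  addLeaf {m} {x} {r} {p} {q} {k} {p′} b tb≡1 link recount s = record
    { graph    = attach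
    ; tree     = attach-tree tree
    ; kind     = kind′
    ; hub      = suc hub
    ; hub-kind = hub-kind
    ; links    = λ {u} {w} → links′ u w
    ; degrees  = degrees′
    ; census   = census′
    }
    where
    open Stage s
    open Attach graph hub
    kind′ : Fin (suc m) → Kind
    kind′ = newKind b kind
    links′ : ∀ u w → AttachAdj u w → Linkable (kind′ u) (kind′ w)
    links′ zero    (suc _) refl = subst (Linkable b) (sym hub-kind) link
    links′ (suc _) zero    refl = swap (subst (Linkable b) (sym hub-kind) link)
    links′ (suc u) (suc w) a    = links a
    degrees′ : ∀ u → degree attach u + ⟦ u Fin.≟ suc hub ⟧ * r ≡ target (kind′ u)
    degrees′ zero    = trans (+-identityʳ _) (trans degree-new (sym tb≡1))
    degrees′ (suc u) = trans (cong (_+ ⟦ u Fin.≟ hub ⟧ * r) (degree-old u))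
                             (trans (arith ⟦ u Fin.≟ hub ⟧ (degree graph u) r) (degrees u))
      where
      arith : ∀ a d r → a + d + a * r ≡ d + a * suc r
      arith = solve-∀
    census′ : Census kind′ p′ q k
    census′ f fl ft = begin
      ∑[ v ∈ V (suc m) ] f (kind′ v)                   ≡⟨ ∑V-suc (λ v → f (kind′ v)) ⟩
      f b + (∑[ v ∈ V m ] f (kind v))                  ≡⟨ cong (f b +_) (census f fl ft) ⟩
      f b + (p * f pending + rest)                     ≡⟨ +-assoc (f b) (p * f pending) rest ⟨
      f b + p * f pending + rest                       ≡⟨ cong (_+ rest) (recount f fl) ⟨
      p′ * f pending + rest                            ∎
      where
      open ≡-Reasoning
      rest = q * f centre + k * f big

  fillBig : ∀ {p q k} r → Stage m big r p q k → Stage (r + m) big 0 p q k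
  fillBig zero    s = s
  fillBig {m} {p} {q} {k} (suc r) s = subst (λ m → Stage m big 0 p q k) (+-suc r m)
    (fillBig r (addLeaf leaf refl (inj₁ leaf-big) (λ f fl → cong (_+ p * f pending) (sym fl)) s))

  fillPending : ∀ {x p q k} r → Linkable pending x → Stage m x r p q k → Stage (r + m) x 0 (r + p) q k
  fillPending zero    link s = s
  fillPending {m} {x} {p} {q} {k} (suc r) link s = subst₂ (λ m p → Stage m x 0 p q k) (+-suc r m) (+-suc r p)
    (fillPending r link (addLeaf pending refl link (λ f _ → refl) s))

  -- The degree of `z` rises from 1 to 2, and its new child becomes the hub, which already has the
  -- neighbour `z` and so lacks Δ ∸ 1 leaves. `recount` removes the old kind of `z` from the census:
  -- `p` is `suc p′` for a pending `z` and `p′` for a leaf.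
  sprout : ∀ {x p q k p′} (s : Stage m x 0 p q k) (z : Fin m) → Expandable (Stage.kind s z) →
           (∀ f → f leaf ≡ 0 → p * f pending ≡ p′ * f pending + f (Stage.kind s z)) →
           Stage (suc m) big (Δ ∸ 1) p′ q (suc k)
  sprout {m} {x} {p} {q} {k} {p′} s z ez recount = record
    { graph    = attach
    ; tree     = attach-tree tree
    ; kind     = kind′
    ; hub      = zero
    ; hub-kind = refl
    ; links    = λ {u} {w} → links′ u w
    ; degrees  = degrees′
    ; census   = census′
    }
    where
    open Stage s
    open Attach graph z
    relabelled : ∀ {u} → Dec (u ≡ z) → Kind
    relabelled {u} e = if does e then two else kind u
    kind′ : Fin (suc m) → Kind
    kind′ = newKind big (λ u → relabelled (u Fin.≟ z))
    relabelled-z : ∀ {u} (e : Dec (u ≡ z)) → u ≡ z → relabelled e ≡ two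
    relabelled-z (yes _) _ = refl
    relabelled-z (no ne) e = contradiction e ne
    links-old : ∀ {u w} → SimpleGraph.Adj graph u w → (e : Dec (u ≡ z)) (f : Dec (w ≡ z)) →
                Linkable (relabelled e) (relabelled f)
    links-old a (yes _)    (yes _)    = inj₁ two-two
    links-old a (yes refl) (no _)     = expand-link ez (links a)
    links-old a (no _)     (yes refl) = swap (expand-link ez (swap (links a)))
    links-old a (no _)     (no _)     = links a
    links′ : ∀ u w → AttachAdj u w → Linkable (kind′ u) (kind′ w)
    links′ zero    (suc w) e = subst (Linkable big) (sym (relabelled-z (w Fin.≟ z) e)) (inj₂ two-big)
    links′ (suc u) zero    e = subst (λ y → Linkable y big) (sym (relabelled-z (u Fin.≟ z) e)) (inj₁ two-big)
    links′ (suc u) (suc w) a = links-old a (u Fin.≟ z) (w Fin.≟ z)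
    exact : ∀ u → degree graph u ≡ target (kind u)
    exact u = trans (sym (trans (cong (degree graph u +_) (*-zeroʳ ⟦ u Fin.≟ hub ⟧)) (+-identityʳ _))) (degrees u)
    target-z : ∀ {y} → Expandable y → target y ≡ 1
    target-z pending = refl
    target-z leaf    = refl
    degrees-old : ∀ {u} (e : Dec (u ≡ z)) → ⟦ e ⟧ + degree graph u ≡ target (relabelled e)
    degrees-old (yes refl) = cong suc (trans (exact z) (target-z ez))
    degrees-old {u} (no _) = exact u
    degrees′ : ∀ u → degree attach u + ⟦ u Fin.≟ zero ⟧ * (Δ ∸ 1) ≡ target (kind′ u)
    degrees′ zero    = trans (cong₂ _+_ degree-new (*-identityˡ (Δ ∸ 1))) (m+[n∸m]≡n (≤-trans (s≤s z≤n) 3≤Δ))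
    degrees′ (suc u) = trans (+-identityʳ _) (trans (degree-old u) (degrees-old (u Fin.≟ z)))
    census′ : Census kind′ p′ q (suc k)
    -- The relabelled `z` has weight 0; adding its former weight on both sides restores the old
    -- census without subtraction.
    census′ f fl ft = +-cancelʳ-≡ (f (kind z)) _ _ (begin
      (∑[ v ∈ V (suc m) ] f (kind′ v)) + f (kind z)             ≡⟨ cong (_+ f (kind z)) (∑V-suc (λ v → f (kind′ v))) ⟩
      f big + ∑ (V m) old + f (kind z)                          ≡⟨ +-assoc (f big) (∑ (V m) old) (f (kind z)) ⟩
      f big + (∑ (V m) old + f (kind z))                        ≡⟨ cong (f big +_) (begin
        ∑ (V m) old + f (kind z)
          ≡⟨ cong (∑ (V m) old +_) (trans (∑-*ʳ (V m) (f (kind z)) (λ u → ⟦ u Fin.≟ z ⟧))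
            (trans (cong (_* f (kind z)) (∑V-δ z)) (*-identityˡ _))) ⟨
        ∑ (V m) old + (∑[ u ∈ V m ] ⟦ u Fin.≟ z ⟧ * f (kind z))    ≡⟨ ∑-+ (V m) old (λ u → ⟦ u Fin.≟ z ⟧ * f (kind z)) ⟨
        ∑[ u ∈ V m ] (old u + ⟦ u Fin.≟ z ⟧ * f (kind z))         ≡⟨ ∑-cong (V m) (λ u → pointwise (u Fin.≟ z)) ⟩
        ∑[ u ∈ V m ] f (kind u)                                   ≡⟨ census f fl ft ⟩
        p * f pending + (q * f centre + k * f big)
          ≡⟨ cong (_+ (q * f centre + k * f big)) (recount f fl) ⟩
        p′ * f pending + f (kind z) + (q * f centre + k * f big)  ∎) ⟩
      f big + (p′ * f pending + f (kind z) + (q * f centre + k * f big))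
        ≡⟨ arith (f big) (p′ * f pending) (f (kind z)) (q * f centre) (k * f big) ⟩
      p′ * f pending + (q * f centre + suc k * f big) + f (kind z) ∎)
      where
      open ≡-Reasoning
      old : Fin m → ℕ
      old u = f (relabelled (u Fin.≟ z))
      arith : ∀ b p z c k → b + (p + z + (c + k)) ≡ p + (c + (b + k)) + z
      arith = solve-∀
      pointwise : ∀ {u} (e : Dec (u ≡ z)) → f (relabelled e) + ⟦ e ⟧ * f (kind z) ≡ f (kind u)
      pointwise (yes refl) = trans (cong (_+ (f (kind z) + 0)) ft) (+-identityʳ _)
      pointwise (no _)     = +-identityʳ _

  module Complete {x p q k} (s : Stage m x 0 p q k) where
    open Stage s public

    exact : ∀ u → degree graph u ≡ target (kind u)
    exact u = trans (sym (trans (cong (degree graph u +_) (*-zeroʳ ⟦ u Fin.≟ hub ⟧)) (+-identityʳ _))) (degrees u)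

    target≥1 : ∀ y → 1 ≤ target y
    target≥1 pending = ≤-refl
    target≥1 leaf    = ≤-refl
    target≥1 two     = s≤s z≤n
    target≥1 centre  = ≤-trans (s≤s z≤n) 2≤c
    target≥1 big     = ≤-trans (s≤s z≤n) 3≤Δ

    degree≥1 : ∀ u → 1 ≤ degree graph u
    degree≥1 u = subst (1 ≤_) (sym (exact u)) (target≥1 (kind u))

    isPending : Kind → ℕ
    isPending pending = 1
    isPending _       = 0

    isPending⇒ : ∀ {y} → isPending y ≢ 0 → y ≡ pending
    isPending⇒ {pending} _  = refl
    isPending⇒ {leaf}    ne = contradiction refl ne
    isPending⇒ {two}     ne = contradiction refl ne
    isPending⇒ {centre}  ne = contradiction refl ne
    isPending⇒ {big}     ne = contradiction refl ne

    #pending : ∑[ v ∈ V m ] isPending (kind v) ≡ p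
    #pending = trans (census isPending refl refl) (arith p q k)
      where
      arith : ∀ p q k → p * 1 + (q * 0 + k * 0) ≡ p
      arith = solve-∀

    somePending : p ≢ 0 → ∃[ z ] kind z ≡ pending
    somePending p≢0 with ∑≢0⇒∃ (V m) (isPending ∘ kind) (λ e → p≢0 (trans (sym #pending) e))
    ... | z , ne = z , isPending⇒ ne

    nonePending : p ≡ 0 → ∀ z → kind z ≢ pending
    nonePending p≡0 z e = contradiction (subst₂ _≤_ (cong isPending e) (trans #pending p≡0)
      (∈⇒≤∑ (V m) (isPending ∘ kind) (∈-allFin z))) λ ()

    target≡1⇒ : ∀ {y} → target y ≡ 1 → y ≢ pending → y ≡ leaf
    target≡1⇒ {pending} _ ne = contradiction refl ne
    target≡1⇒ {leaf}    _ _  = refl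
    target≡1⇒ {centre}  e _  = contradiction e (>⇒≢ 2≤c)
    target≡1⇒ {big}     e _  = contradiction e (>⇒≢ (≤-trans (n≤1+n 2) 3≤Δ))

    -- `leafCount` gives at least two vertices of degree 1, and with nothing pending and c ≥ 2 these
    -- are of kind `leaf`. Thus expansion never gets stuck.
    someLeaf : p ≡ 0 → ∃[ z ] kind z ≡ leaf
    someLeaf p≡0 with ∑≢0⇒∃ (V m) (λ v → ⟦ degree graph v ≟ 1 ⟧)
      (λ e → contradiction (trans (sym (TreeSize.leafCount graph tree degree≥1)) e) λ ())
    ... | z , ne with degree graph z ≟ 1
    ...   | yes e = z , target≡1⇒ (trans (sym (exact z)) e) (nonePending p≡0 z)
    ...   | no ne′ = contradiction (⟦⟧-no (degree graph z ≟ 1) ne′) ne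

  fullBig : ∀ {p q k} → Stage (suc m) big (Δ ∸ 1) p q k → Stage (Δ + m) big 0 p q k
  fullBig {m} {p} {q} {k} s = subst (λ m → Stage m big 0 p q k)
    (trans (+-suc (Δ ∸ 1) m) (cong (_+ m) (m+[n∸m]≡n {1} (≤-trans (s≤s z≤n) 3≤Δ)))) (fillBig (Δ ∸ 1) s)

  expandPending : ∀ {x p q k} → Stage m x 0 (suc p) q k → Stage (Δ + m) big 0 p q (suc k)
  expandPending {p = p} s with Complete.somePending s (λ ())
  ... | z , e = fullBig (sprout s z (subst Expandable (sym e) pending)
                  (λ f _ → trans (+-comm (f pending) (p * f pending)) (cong (λ y → p * f pending + f y) (sym e))))

  expandLeaf : ∀ {x q k} → Stage m x 0 0 q k → Stage (Δ + m) big 0 0 q (suc k)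
  expandLeaf s with Complete.someLeaf s refl
  ... | z , e = fullBig (sprout s z (subst Expandable (sym e) leaf) (λ f fl → sym (trans (cong f e) fl)))

  expandAllPending : ∀ {x q k} p → Stage m x 0 p q k → ∃[ y ] Stage (p * Δ + m) y 0 0 q (p + k)
  expandAllPending zero s = _ , s
  expandAllPending {m} {q = q} {k} (suc p) s with expandAllPending p (expandPending s)
  ... | y , t = y , subst₂ (λ m k → Stage m y 0 0 q k) (arith p Δ m) (+-suc p k) t
    where
    arith : ∀ p d m → p * d + (d + m) ≡ d + p * d + m
    arith = solve-∀

  expandLeaves : ∀ {x q k} l → Stage m x 0 0 q k → ∃[ y ] Stage (l * Δ + m) y 0 0 q (l + k)
  expandLeaves zero s = _ , s
  expandLeaves {m} {q = q} {k} (suc l) s with expandLeaves l s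
  ... | y , t = big , subst (λ m → Stage m big 0 0 q (suc (l + k))) (sym (+-assoc Δ (l * Δ) m)) (expandLeaf t)

  -- The pending vertices take `p` of the `k` expansions, arbitrary leaves the other `k ∸ p`. The
  -- bound `p ≤ k` is what `Δ ∸ 1 ≤ k` is for.
  expandTo : ∀ {x q p} k → p ≤ k → Stage m x 0 p q 0 → ∃[ y ] Stage (k * Δ + m) y 0 0 q k
  expandTo {m} {q = q} {p = p} k p≤k s with expandAllPending p s
  ... | _ , t with expandLeaves (k ∸ p) t
  ...   | y , u = y , subst₂ (λ m k → Stage m y 0 0 q k)
    (trans (arith (k ∸ p) p Δ m) (cong (λ k → k * Δ + m) (m∸n+n≡m p≤k)))
    (trans (cong (k ∸ p +_) (+-identityʳ p)) (m∸n+n≡m p≤k)) u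
    where
    arith : ∀ l p d m → l * d + (p * d + m) ≡ (l + p) * d + m
    arith = solve-∀

  start : ∀ (y : Kind) {p q} → (∀ f → f y ≡ p * f pending + q * f centre) → Stage 1 y (target y) p q 0
  start y {p} {q} weight = record
    { graph    = singleton
    ; tree     = singleton-tree
    ; kind     = λ _ → y
    ; hub      = zero
    ; hub-kind = refl
    ; links    = λ ()
    ; degrees  = λ { zero → *-identityˡ (target y) }
    ; census   = λ f _ _ → trans (+-identityʳ (f y)) (trans (weight f)
        (cong (p * f pending +_) (sym (+-identityʳ (q * f centre)))))
    }

  module Finished {x q k} (s : Stage m x 0 0 q k) where
    open Complete s

    link-type : ∀ {y z} → Link y z → y ≢ pending → EdgeType Δ (target y) (target z)
    link-type leaf-big        _  = leaf
    link-type two-big         _  = two (≤-trans (n≤1+n 2) 3≤Δ)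
    link-type two-two         _  = two ≤-refl
    link-type two-centre      _  = two 2≤c
    link-type pending-centre  ne = contradiction refl ne
    link-type pending-two     ne = contradiction refl ne
    link-type pending-pending ne = contradiction refl ne

    typed : EdgesTyped graph Δ
    typed {u} {w} a = subst₂ (λ a b → EdgeType Δ a b ⊎ EdgeType Δ b a) (sym (exact u)) (sym (exact w))
      ([ (λ l → inj₁ (link-type l (nonePending refl u))) , (λ l → inj₂ (link-type l (nonePending refl w))) ] (links a))

    target≤Δ : ∀ y → target y ≤ Δ
    target≤Δ pending = ≤-trans (s≤s z≤n) 3≤Δ
    target≤Δ leaf    = ≤-trans (s≤s z≤n) 3≤Δ
    target≤Δ two     = ≤-trans (n≤1+n 2) 3≤Δ
    target≤Δ centre  = <⇒≤ c<Δ
    target≤Δ big     = ≤-refl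

    isBig : Kind → ℕ
    isBig big = 1
    isBig _   = 0

    isBig⇒ : ∀ {y} → isBig y ≢ 0 → y ≡ big
    isBig⇒ {pending} ne = contradiction refl ne
    isBig⇒ {leaf}    ne = contradiction refl ne
    isBig⇒ {two}     ne = contradiction refl ne
    isBig⇒ {centre}  ne = contradiction refl ne
    isBig⇒ {big}     _  = refl

    maxDegree : k ≢ 0 → IsMaxDegree graph Δ
    maxDegree k≢0 = (λ v → subst (_≤ Δ) (sym (exact v)) (target≤Δ (kind v))) , someBig
      where
      arith : ∀ q k → q * 0 + k * 1 ≡ k
      arith = solve-∀
      someBig : ∃[ v ] degree graph v ≡ Δ
      someBig with ∑≢0⇒∃ (V m) (isBig ∘ kind) (λ e → k≢0 (trans (sym (trans (census isBig refl refl) (arith q k))) e))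
      ... | v , ne = v , trans (exact v) (cong target (isBig⇒ ne))

    -- `centre-weight` covers both starting trees: `q` is 1 and `c` is `j` for the star, while for
    -- K₂ `q` is 0 and `j` is 1, where `F` vanishes.
    profile : ∀ {j} → (∀ F → F 1 ≡ 0 → q * F c ≡ F j) → DegreeProfile graph Δ k j
    profile {j} centre-weight F F1 F2 = begin
      ∑[ v ∈ V m ] F (degree graph v)          ≡⟨ ∑-cong (V m) (λ v → cong F (exact v)) ⟩
      ∑[ v ∈ V m ] F (target (kind v))         ≡⟨ census (F ∘ target) F1 F2 ⟩
      q * F c + k * F Δ                        ≡⟨ cong (_+ k * F Δ) (centre-weight F F1) ⟩
      F j + k * F Δ                            ≡⟨ +-comm (F j) (k * F Δ) ⟩
      k * F Δ + F j                            ∎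
      where open ≡-Reasoning

-- Trees from the two starting graphs, and the theorem

finish : ∀ {Δ c n k j x q} (6≤Δ : 6 ≤ Δ) (2≤c : 2 ≤ c) (c<Δ : c < Δ) (3≤Δ : 3 ≤ Δ) →
         1 ≤ j → j < Δ → 1 ≤ k → n ≡ k * Δ + 1 + j → (∀ F → F 1 ≡ 0 → q * F c ≡ F j) →
         Construction.Stage Δ c 3≤Δ 2≤c c<Δ n x 0 0 q k → ∃[ T ] 𝒯′ n Δ T
finish {Δ} {c} {n} {k} {j} {q = q} 6≤Δ 2≤c c<Δ 3≤Δ 1≤j j<Δ 1≤k n≡ centre-weight s =
  graph , Criterion.member {k = k} {j} graph 6≤Δ 1≤j j<Δ n≡ tree typed (profile {j} centre-weight) (maxDegree (>⇒≢ 1≤k))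
  where
  open Construction Δ c 3≤Δ 2≤c c<Δ
  open Stage s using (graph; tree)
  open Finished s

nonempty : ∀ {Δ n k} j → 6 ≤ Δ → n ≡ k * Δ + 1 + j → Δ ∸ 1 ≤ k → 1 ≤ j → j < Δ → ∃[ T ] 𝒯′ n Δ T
nonempty {Δ} {n} {k} 1 6≤Δ n≡ Δ-1≤k 1≤j j<Δ =
  finish 6≤Δ ≤-refl 3≤Δ 3≤Δ 1≤j j<Δ (≤-trans (s≤s z≤n) 2≤k) n≡ (λ F F1 → sym F1)
    (subst (λ n → Stage n (proj₁ stage) 0 0 0 k) (trans (sym (+-assoc (k * Δ) 1 1)) (sym n≡)) (proj₂ stage))
  where
  3≤Δ : 3 ≤ Δ
  3≤Δ = ≤-trans (m≤n+m 3 3) 6≤Δ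
  2≤k : 2 ≤ k
  2≤k = ≤-trans (∸-monoˡ-≤ 1 3≤Δ) Δ-1≤k
  -- K₂ has no vertex of kind `centre`; the value 2 is a placeholder for its degree.
  open Construction Δ 2 3≤Δ ≤-refl 3≤Δ
  stage : ∃[ y ] Stage (k * Δ + 2) y 0 0 0 k
  -- A pending vertex is itself a hub lacking one leaf, and that leaf is pending too: this is K₂
  -- with two pending ends.
  stage = expandTo k 2≤k (fillPending 1 (inj₁ pending-pending)
    (start pending (λ f → arith (f pending) (f centre))))
    where
    arith : ∀ x y → x ≡ 1 * x + 0 * y
    arith = solve-∀
nonempty {Δ} {n} {k} j@(suc (suc _)) 6≤Δ n≡ Δ-1≤k 1≤j j<Δ =
  finish 6≤Δ 2≤j j<Δ 3≤Δ 1≤j j<Δ (≤-trans 1≤j j≤k) n≡ (λ F _ → *-identityˡ (F j))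
    (subst (λ n → Stage n (proj₁ stage) 0 0 1 k) (trans (arith (k * Δ) j) (sym n≡)) (proj₂ stage))
  where
  3≤Δ : 3 ≤ Δ
  3≤Δ = ≤-trans (m≤n+m 3 3) 6≤Δ
  2≤j : 2 ≤ j
  2≤j = s≤s (s≤s z≤n)
  j≤k : j ≤ k
  j≤k = ≤-trans (∸-monoˡ-≤ 1 j<Δ) Δ-1≤k
  open Construction Δ j 3≤Δ 2≤j j<Δ
  arith : ∀ x y → x + (y + 1) ≡ x + 1 + y
  arith = solve-∀
  stage : ∃[ y ] Stage (k * Δ + (j + 1)) y 0 0 1 k
  stage = expandTo k j≤k (subst (λ p → Stage (j + 1) centre 0 p 1 0) (+-identityʳ j)
    (fillPending j (inj₁ pending-centre) (start centre (λ f → arith′ (f pending) (f centre)))))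
    where
    arith′ : ∀ x y → y ≡ 0 * x + 1 * y
    arith′ = solve-∀

proposition4 : (Δ n k j : ℕ) → 6 ≤ Δ → n ≡ k * Δ + 1 + j →
    Δ ∸ 1 ≤ k → 1 ≤ j → j ≤ Δ ∸ 1 →
    (∃[ T ] 𝒯′ n Δ T) ×
    (∀ (T T′ : SimpleGraph n) → 𝒯′ n Δ T → 𝒯′ n Δ T′ → σ T ≡ σ T′)
proposition4 Δ n k j 6≤Δ n≡ Δ-1≤k 1≤j j≤Δ-1 =
  nonempty j 6≤Δ n≡ Δ-1≤k 1≤j j<Δ ,
  λ T T′ M M′ → trans (Members.σ-member T 6≤Δ M {k} {j} n≡ j<Δ) (sym (Members.σ-member T′ 6≤Δ M′ {k} {j} n≡ j<Δ))
  where
  j<Δ : j < Δ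
  j<Δ = subst (suc j ≤_) (m+[n∸m]≡n (≤-trans (s≤s z≤n) 6≤Δ)) (s≤s j≤Δ-1)
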